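{- Let $S$ be the projective plane. If $G$ is a graph of order $n\geq 4$ whose edge set can be partitioned into $k$ Hamiltonian cycles of $G$, then $\theta_S(4,F_2(G))=k$.
   Context: A Hamiltonian cycle of $G$ is a cycle in $G$ containing every vertex of $G$. The $2$-token graph $F_2(G)$ has as vertices all $2$-element subsets of $V(G)$, two such subsets $X,Y$ being adjacent iff their symmetric difference is $\{x,y\}$ with $x\in X$, $y\in Y$ and $xy\in E(G)$. The girth of a graph is the length of its shortest cycle, or $\infty$ if it is acyclic. For a surface $S$, the $S$-$g$-girth-thickness $\theta_S(g,H)$ of a graph $H$ is the minimum number of subgraphs of $H$, each embeddable on $S$ and of girth at least $g$, whose union is $H$. -}

module Defs where

open import Data.Nat as ℕ using (ℕ; zero; suc; _+_; _≤_; s≤s)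
open import Data.Fin using (Fin; toℕ; fromℕ<) renaming (_<_ to _<ᶠ_)
open import Data.Product using (Σ; ∃; _×_; _,_; proj₁; proj₂)
open import Data.Sum using (_⊎_)
open import Data.List using (List; []; _∷_)
open import Data.List.Membership.Propositional using (_∈_)
open import Relation.Nullary using (¬_; yes; no)
open import Relation.Binary.PropositionalEquality using (_≡_)
open import Function.Bundles using (_⇔_)
open import Function.Definitions using (Injective; Surjective)

Rel : Set → Set₁
Rel V = V → V → Set

record Graph (n : ℕ) : Set₁ where
  field
    E      : Rel (Fin n)
    sym    : ∀ {u v} → E u v → E v u
    irrefl : ∀ {u} → ¬ E u u

next : ∀ {n} → Fin n → Fin n
next {suc n} i with toℕ i ℕ.<? n
... | yes p = fromℕ< {suc (toℕ i)} {suc n} (s≤s p)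
... | no _  = Data.Fin.zero

-- A Hamiltonian cycle of G (n ≥ 3): a cyclic ordering c 0, …, c (n-1)
-- of all vertices (c is injective, hence a bijection of Fin n) in which
-- cyclically consecutive vertices are adjacent in G.
record HamiltonianCycle {n : ℕ} (G : Graph n) : Set where
  field
    c     : Fin n → Fin n
    c-inj : Injective _≡_ _≡_ c
    c-adj : ∀ i → Graph.E G (c i) (c (next i))

CycleEdge : ∀ {n} {G : Graph n} → HamiltonianCycle G → Rel (Fin n)
CycleEdge H u v =
  ∃ λ i → (u ≡ c i × v ≡ c (next i)) ⊎ (v ≡ c i × u ≡ c (next i))
  where open HamiltonianCycle H

-- The edge set of G can be partitioned into k Hamiltonian cycles of G:
-- every edge of G lies on exactly one of the k cycles
-- (cycle edges are edges of G by definition of HamiltonianCycle).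
HamDecomposition : ∀ {n} → Graph n → ℕ → Set
HamDecomposition {n} G k =
  Σ (Fin k → HamiltonianCycle G) λ cs →
    (∀ u v → Graph.E G u v → ∃ λ j → CycleEdge (cs j) u v) ×
    (∀ u v j j' → CycleEdge (cs j) u v → CycleEdge (cs j') u v → j ≡ j')

Pair : ℕ → Set
Pair n = Σ (Fin n × Fin n) λ p → proj₁ p <ᶠ proj₂ p

_∈₂_ : ∀ {n} → Fin n → Pair n → Set
z ∈₂ ((a , b) , _) = z ≡ a ⊎ z ≡ b

-- X ~ Y iff X △ Y = {x , y} with x ∈ X, y ∈ Y and xy ∈ E(G)
F₂ : ∀ {n} → Graph n → Rel (Pair n)
F₂ G X Y = Σ _ λ x → Σ _ λ y →
  Graph.E G x y ×
  (x ∈₂ X) × ¬ (x ∈₂ Y) × (y ∈₂ Y) × ¬ (y ∈₂ X) ×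
  (∀ z → z ∈₂ X → ¬ (z ∈₂ Y) → z ≡ x) ×
  (∀ z → z ∈₂ Y → ¬ (z ∈₂ X) → z ≡ y)

GirthAtLeast : ∀ {V : Set} → ℕ → Rel V → Set
GirthAtLeast {V} g R =
  ∀ ℓ → 3 ≤ ℓ → suc ℓ ≤ g → (c : Fin ℓ → V) → Injective _≡_ _≡_ c →
    ¬ (∀ i → R (c i) (c (next i)))

-- orbit relation of the group generated by a list of permutations
data Reach {f : ℕ} (gs : List (Fin f → Fin f)) : Fin f → Fin f → Set where
  here : ∀ {x} → Reach gs x x
  step : ∀ {x y t} → t ∈ gs → Reach gs (t x) y → Reach gs x y

-- q : Fin f → Fin c is a surjective orbit map of ⟨gs⟩, i.e. the
-- orbits of ⟨gs⟩ are exactly the fibres of q (so there are c orbits)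
OrbitMap : ∀ {f} → List (Fin f → Fin f) → (c : ℕ) → (Fin f → Fin c) → Set
OrbitMap gs c q =
  Surjective _≡_ _≡_ q × (∀ x y → (q x ≡ q y) ⇔ Reach gs x y)

FPFInvolution : ∀ {f} → (Fin f → Fin f) → Set
FPFInvolution t = (∀ x → t (t x) ≡ x) × (∀ x → ¬ (t x ≡ x))

-- A combinatorial map (graph-encoded map) with f flags, in the sense of
-- Lins / Mohar–Thomassen: three fixed-point-free involutions τ₀ τ₁ τ₂ with
-- τ₀τ₂ a fixed-point-free involution, generating a transitive group.
-- Vertices / edges / faces are the orbits of ⟨τ₁,τ₂⟩ / ⟨τ₀,τ₂⟩ / ⟨τ₀,τ₁⟩.
-- Here the map is cellularly embedded in the projective plane, i.e. its
-- Euler characteristic V - E + F equals 1.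
record ProjectivePlaneMap : Set where
  field
    flags : ℕ
    τ₀ τ₁ τ₂ : Fin flags → Fin flags
    τ₀-inv : FPFInvolution τ₀
    τ₁-inv : FPFInvolution τ₁
    τ₂-inv : FPFInvolution τ₂
    τ₀τ₂-comm : ∀ x → τ₀ (τ₂ x) ≡ τ₂ (τ₀ x)
    τ₀τ₂-fpf  : ∀ x → ¬ (τ₀ (τ₂ x) ≡ x)
    connected : ∀ x y → Reach (τ₀ ∷ τ₁ ∷ τ₂ ∷ []) x y
    #V #E #F : ℕ
    vert : Fin flags → Fin #V
    edge : Fin flags → Fin #E
    face : Fin flags → Fin #F
    vert-orbits : OrbitMap (τ₁ ∷ τ₂ ∷ []) #V vert
    edge-orbits : OrbitMap (τ₀ ∷ τ₂ ∷ []) #E edge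
    face-orbits : OrbitMap (τ₀ ∷ τ₁ ∷ []) #F face
    euler : #V + #F ≡ #E + 1

-- the underlying graph of a map: vertices a, b adjacent iff some edge of
-- the map joins them (a flag at a whose τ₀-image lies at b)
MapAdj : (M : ProjectivePlaneMap) →
         Rel (Fin (ProjectivePlaneMap.#V M))
MapAdj M a b = ∃ λ x → vert x ≡ a × vert (τ₀ x) ≡ b
  where open ProjectivePlaneMap M

-- A graph (edge relation R on V) embeds in the projective plane iff it is
-- a subgraph of (the underlying graph of) a map cellularly embedded in the
-- projective plane.
EmbedsInProjectivePlane : ∀ {V : Set} → Rel V → Set
EmbedsInProjectivePlane {V} R =
  Σ ProjectivePlaneMap λ M →
  Σ (V → Fin (ProjectivePlaneMap.#V M)) λ φ →
    Injective _≡_ _≡_ φ × (∀ a b → R a b → MapAdj M (φ a) (φ b))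

PPGirthCover : ∀ {V : Set} → ℕ → Rel V → ℕ → Set₁
PPGirthCover {V} g H j =
  Σ (Fin j → Rel V) λ P →
    (∀ i a b → P i a b → H a b) ×
    (∀ i a b → P i a b → P i b a) ×
    (∀ a b → H a b → ∃ λ i → P i a b) ×
    (∀ i → EmbedsInProjectivePlane (P i) × GirthAtLeast g (P i))

PPGirthThicknessIs : ∀ {V : Set} → ℕ → Rel V → ℕ → Set₁
PPGirthThicknessIs g H k =
  PPGirthCover g H k × (∀ j → suc j ≤ k → ¬ PPGirthCover g H j)

{-# OPTIONS --safe #-}

-- Upper bound: for a Hamiltonian cycle C of length n ≥ 4, F₂(C) is triangle-free and is drawn on a
-- triangular half {i < j} of an n × n grid, the edges wrapping round C joining (i , n-1) to (0 , i);
-- gluing the sides of the square accordingly gives a projective plane.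
--
-- Lower bound: a triangle-free subgraph of a projective planar map with m edges and N ≥ 2 vertices
-- has m ≤ 2N - 2. Delete from the map all edges outside the subgraph, merging the two faces at each
-- deleted edge. A deleted edge that merged two different regions is redundant for connectivity,
-- because a vertex 2-colouring changes an even number of times along the boundary of a region.
-- Counting vertices with the remaining deleted edges and Euler's formula gives at least m + 1 - N
-- regions. If there are at least two, each has a nonempty boundary which is even at every vertex,
-- hence consists of at least four edges, and there are at most m / 2 regions.
-- As F₂(G) has k n (n-2) edges and n (n-1) / 2 vertices, j subgraphs cover it only if
-- k n ≤ j (n+1); since k < n, this forces j ≥ k.
module Submission where

open import Defs
open import Algebra.Bundles using (CommutativeMonoid; CommutativeRing)
open import Data.Bool using (Bool; true; false; not; _∧_; _xor_)
import Data.Bool.Properties as Boolₚ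
open import Data.Empty using (⊥; ⊥-elim)
open import Data.Fin as Fin
  using (Fin; zero; suc; toℕ; fromℕ; inject₁; opposite; punchIn; punchOut; splitAt; join; combine; remQuot)
open import Data.Fin.Induction using (<-weakInduction)
open import Data.Fin.Permutation using (permutation)
import Data.Fin.Properties as Finₚ
open import Data.Fin.Relation.Unary.Top using (view; ‵fromℕ; ‵inject₁; view-fromℕ; view-inject₁)
open import Data.List using (List; []; _∷_; _++_; length; map; allFin)
open import Data.List.Membership.Propositional using (_∈_)
open import Data.List.Membership.Propositional.Properties using (∈-map⁺; ∈-map⁻; ∈-++⁺ˡ; ∈-++⁺ʳ; ∈-allFin)
open import Data.List.Properties using (length-map; length-++; length-tabulate)
open import Data.List.Relation.Unary.Any using (here; there)
open import Data.Maybe using (Maybe; just; nothing)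
open import Data.Nat as ℕ using (ℕ; zero; suc; _+_; _*_; _≤_; _<_; z≤n; s≤s)
import Data.Nat.Properties as ℕₚ
open import Data.Nat.Tactic.RingSolver using (solve-∀)
open import Data.Product using (∃; ∃₂; _×_; _,_; proj₁; proj₂)
open import Data.Product.Function.NonDependent.Propositional using (_×-↔_)
open import Data.Sum using (_⊎_; inj₁; inj₂; [_,_]; map₁; map₂; swap)
open import Function using (_∘_; id)
open import Function.Bundles using (Equivalence; Inverse; _↔_; mk↔ₛ′; mk⇔)
open import Function.Construct.Composition using (_↔-∘_)
open import Function.Definitions using (Injective; Surjective)
open import Level using (0ℓ)
open import Relation.Binary.Definitions using (tri<; tri≈; tri>)
open import Relation.Binary.PropositionalEquality hiding ([_])
open import Relation.Nullary using (¬_; yes; no; does; contradiction)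
open import Relation.Nullary.Decidable using (dec-true; dec-false; _×-dec_; ¬?)
open import Relation.Unary using (Pred; Decidable)

-- Parity, quotients and counting on finite sets

-- No smaller map is ever built: deleting an edge would mean re-forming all flags. The map stays
-- fixed, and a deletion only coarsens the labelling of its faces by regions. The price is that a
-- region is a mere set of faces without a boundary walk. Arguments about its boundary are therefore
-- parity counts of flags under two involutions, one of them the fixed-point-free `τ₁`. Connectivity
-- is likewise expressed by 2-colourings of the vertices instead of paths, since colour changes are
-- something a parity count can see.
--
-- The subgraph may be disconnected and its regions need not be discs, so Euler's formula survives
-- only as an inequality. Identifying its N vertices costs N - 1 identifications and turns its edges
-- into loops; the uncut deleted edges must then hold everything together, which bounds the number
-- of vertices of the map.
--
-- The constants fit because 2N - 2 = n(n-1) - 2 = (n-2)(n+1), so n-2 cancels against the edge count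
-- k n (n-2). That k < n holds because the k cycles leave a fixed vertex towards k different
-- neighbours.

xorMonoid : CommutativeMonoid 0ℓ 0ℓ
xorMonoid = CommutativeRing.+-commutativeMonoid Boolₚ.xor-∧-commutativeRing

open import Algebra.Properties.CommutativeMonoid.Sum xorMonoid
  using (sum; sum-cong-≗; sum-permute; ∑-distrib-+; sum-replicate-zero)

xor-sum-point : ∀ {f} (x₀ : Fin f) → sum (λ x → does (x Finₚ.≟ x₀)) ≡ true
xor-sum-point {suc f} zero    = cong (true xor_) (sum-replicate-zero f)
xor-sum-point {suc f} (suc x) = xor-sum-point x

module _ {f} {ρ : Fin f → Fin f} (ρ-invol : ∀ x → ρ (ρ x) ≡ x)
         {A : Pred (Fin f) 0ℓ} (A? : Decidable A) (A-closed : ∀ {x} → A x → A (ρ x)) where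

  private
    a below above fixed : Fin f → Bool
    a     x = does (A? x)
    below x = does (A? x ×-dec (x Finₚ.<? ρ x))
    above x = does (A? x ×-dec (ρ x Finₚ.<? x))
    fixed x = does (A? x ×-dec (ρ x Finₚ.≟ x))

    a-ρ : ∀ x → a (ρ x) ≡ a x
    a-ρ x with A? x
    ... | yes p = dec-true (A? (ρ x)) (A-closed p)
    ... | no ¬p = dec-false (A? (ρ x)) λ p → ¬p (subst A (ρ-invol x) (A-closed p))

    split : ∀ x → a x ≡ fixed x xor (below x xor above x)
    split x with A? x
    ... | no _ = refl
    ... | yes _ with Finₚ.<-cmp x (ρ x)
    ... | tri< p q r rewrite dec-false (ρ x Finₚ.≟ x) (q ∘ sym)
                           | dec-true (x Finₚ.<? ρ x) p | dec-false (ρ x Finₚ.<? x) r = refl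
    ... | tri≈ p q r rewrite dec-true (ρ x Finₚ.≟ x) (sym q)
                           | dec-false (x Finₚ.<? ρ x) p | dec-false (ρ x Finₚ.<? x) r = refl
    ... | tri> p q r rewrite dec-false (ρ x Finₚ.≟ x) (q ∘ sym)
                           | dec-false (x Finₚ.<? ρ x) p | dec-true (ρ x Finₚ.<? x) r = refl

    above≗below∘ρ : ∀ x → above x ≡ below (ρ x)
    above≗below∘ρ x = cong₂ _∧_ (sym (a-ρ x)) (cong (λ y → does (ρ x Finₚ.<? y)) (sym (ρ-invol x)))

  -- The involution `ρ` exchanges the points of `A` with x < `ρ` x and those with `ρ` x < x, so
  -- modulo 2 these two contributions cancel and only the fixed points are left.
  xor-sum-fixed : sum (λ x → does (A? x)) ≡ sum (λ x → does (A? x ×-dec (ρ x Finₚ.≟ x)))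
  xor-sum-fixed = begin
    sum a                                               ≡⟨ sum-cong-≗ split ⟩
    sum (λ x → fixed x xor (below x xor above x))       ≡⟨ ∑-distrib-+ fixed _ ⟩
    sum fixed xor sum (λ x → below x xor above x)       ≡⟨ cong (sum fixed xor_) (∑-distrib-+ below above) ⟩
    sum fixed xor (sum below xor sum above)             ≡⟨ cong (λ s → sum fixed xor (sum below xor s)) above≡below ⟩
    sum fixed xor (sum below xor sum below)             ≡⟨ cong (sum fixed xor_) (Boolₚ.xor-same (sum below)) ⟩
    sum fixed xor false                                 ≡⟨ Boolₚ.xor-identityʳ _ ⟩
    sum fixed                                           ∎
    where
    open ≡-Reasoning
    above≡below : sum above ≡ sum below
    above≡below = trans (sum-cong-≗ above≗below∘ρ)
                        (sym (sum-permute below (permutation ρ ρ ρ-invol ρ-invol)))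

-- Computed through `τ` the size of `A` is even; computed through `ρ` it has the parity of the
-- number of fixed points of `ρ`. Hence no fixed point is alone. This is the handshake argument
-- behind both boundary lemmas below.
second-fixed-point :
  ∀ {f} {τ ρ : Fin f → Fin f} {A : Pred (Fin f) 0ℓ} → Decidable A →
  (∀ x → τ (τ x) ≡ x) → (∀ x → τ x ≢ x) → (∀ {x} → A x → A (τ x)) →
  (∀ x → ρ (ρ x) ≡ x) → (∀ {x} → A x → A (ρ x)) →
  ∀ {x₀} → A x₀ → ρ x₀ ≡ x₀ → ∃ λ x → x ≢ x₀ × A x × ρ x ≡ x
second-fixed-point {f} {τ} {ρ} {A} A? τ-invol τ-fpf A-τ ρ-invol A-ρ {x₀} Ax₀ ρx₀
  with Finₚ.any? (λ x → ¬? (x Finₚ.≟ x₀) ×-dec (A? x ×-dec (ρ x Finₚ.≟ x)))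
... | yes p = p
... | no ¬p = contradiction (trans (sym odd) even) λ ()
  where
  even : sum (λ x → does (A? x)) ≡ false
  even = trans (xor-sum-fixed τ-invol A? A-τ)
    (trans (sum-cong-≗ (λ x → dec-false (A? x ×-dec (τ x Finₚ.≟ x)) (τ-fpf x ∘ proj₂)))
           (sum-replicate-zero f))
  only : ∀ x → does (A? x ×-dec (ρ x Finₚ.≟ x)) ≡ does (x Finₚ.≟ x₀)
  only x with x Finₚ.≟ x₀
  ... | yes refl = dec-true (A? x ×-dec (ρ x Finₚ.≟ x)) (Ax₀ , ρx₀)
  ... | no x≢x₀  = dec-false (A? x ×-dec (ρ x Finₚ.≟ x)) λ q → ¬p (x , x≢x₀ , q)
  odd : sum (λ x → does (A? x)) ≡ true
  odd = trans (xor-sum-fixed ρ-invol A? A-ρ) (trans (sum-cong-≗ only) (xor-sum-point x₀))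

-- The value `b` is punched out of the range and is sent where `a` goes.
merge : ∀ {c} {a b : Fin (suc c)} → a ≢ b → Fin (suc c) → Fin c
merge {_} {a} {b} a≢b x with b Finₚ.≟ x
... | yes _  = punchOut (a≢b ∘ sym)
... | no b≢x = punchOut b≢x

merge-collapses : ∀ {c} {a b : Fin (suc c)} (a≢b : a ≢ b) → merge a≢b a ≡ merge a≢b b
merge-collapses {_} {a} {b} a≢b with b Finₚ.≟ a | b Finₚ.≟ b
... | yes b≡a | _      = contradiction (sym b≡a) a≢b
... | no b≢a  | no b≢b = contradiction refl b≢b
... | no b≢a  | yes _  = Finₚ.punchOut-cong b refl

merge-surjective : ∀ {c} {a b : Fin (suc c)} (a≢b : a ≢ b) (y : Fin c) → ∃ λ x → merge a≢b x ≡ y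
merge-surjective {_} {a} {b} a≢b y = punchIn b y , eq
  where
  eq : merge a≢b (punchIn b y) ≡ y
  eq with b Finₚ.≟ punchIn b y
  ... | yes p = contradiction (sym p) (Finₚ.punchInᵢ≢i b y)
  ... | no p = trans (Finₚ.punchOut-cong b refl) (Finₚ.punchOut-punchIn b)

-- With `same` read as the edges of a graph on `V` points, `bound` is the familiar lower bound on
-- the number of components: each edge lowers that number by at most one.
record Quotient (V : ℕ) (same : List (Fin V × Fin V)) : Set where
  field
    classes : ℕ
    class   : Fin V → Fin classes
    onto    : ∀ y → ∃ λ x → class x ≡ y
    glued   : ∀ {a b} → (a , b) ∈ same → class a ≡ class b
    bound   : V ≤ classes + length same

quotient : ∀ V same → Quotient V same
quotient V [] = record
  { classes = V ; class = id ; onto = λ y → y , refl ; glued = λ () ; bound = ℕₚ.m≤m+n V 0 }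
quotient V ((a , b) ∷ same) with quotient V same
... | Q = extend (Quotient.classes Q) (class Q) (onto Q) (glued Q) (bound Q)
  where
  open Quotient
  extend : ∀ c (q : Fin V → Fin c) → (∀ y → ∃ λ x → q x ≡ y) →
           (∀ {a b} → (a , b) ∈ same → q a ≡ q b) → V ≤ c + length same →
           Quotient V ((a , b) ∷ same)
  extend c q onto glued bound with q a Finₚ.≟ q b
  ... | yes eq = record
    { classes = c ; class = q ; onto = onto
    ; glued = λ { (here refl) → eq ; (there p) → glued p }
    ; bound = ℕₚ.≤-trans bound (ℕₚ.+-monoʳ-≤ c (ℕₚ.n≤1+n _)) }
  extend zero q onto glued bound | no _ = contradiction (q a) λ ()
  extend (suc c) q onto glued bound | no a≢b = record
    { classes = c ; class = merge a≢b ∘ q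
    ; onto = λ y → let x , p = merge-surjective a≢b y ; z , r = onto x
                   in z , trans (cong (merge a≢b) r) p
    ; glued = λ { (here refl) → merge-collapses a≢b ; (there p) → cong (merge a≢b) (glued p) }
    ; bound = subst (V ≤_) (sym (ℕₚ.+-suc c (length same))) bound }

record Split {T : ℕ} (P : Pred (Fin T) 0ℓ) : Set where
  field
    m₁ m₀  : ℕ
    total  : m₁ + m₀ ≡ T
    s₁     : Fin m₁ → Fin T
    s₀     : Fin m₀ → Fin T
    s₁-inj : Injective _≡_ _≡_ s₁
    s₀-inj : Injective _≡_ _≡_ s₀
    s₁-in  : ∀ i → P (s₁ i)
    s₀-out : ∀ i → ¬ P (s₀ i)
    cover  : ∀ t → P t ⊎ ∃ λ i → s₀ i ≡ t

private
  cons : ∀ {m T} → (Fin m → Fin T) → Fin (suc m) → Fin (suc T)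
  cons s zero    = zero
  cons s (suc i) = suc (s i)

  cons-inj : ∀ {m T} {s : Fin m → Fin T} → Injective _≡_ _≡_ s → Injective _≡_ _≡_ (cons s)
  cons-inj s-inj {zero}  {zero}  _ = refl
  cons-inj s-inj {suc i} {suc j} e = cong suc (s-inj (Finₚ.suc-injective e))

split : ∀ {T} {P : Pred (Fin T) 0ℓ} → Decidable P → Split P
split {zero} P? = record
  { m₁ = 0 ; m₀ = 0 ; total = refl ; s₁ = λ () ; s₀ = λ ()
  ; s₁-inj = λ { {()} } ; s₀-inj = λ { {()} } ; s₁-in = λ () ; s₀-out = λ () ; cover = λ () }
split {suc T} {P} P? with P? zero | split (P? ∘ suc)
... | yes p | R = record
  { m₁ = suc (m₁ R) ; m₀ = m₀ R ; total = cong suc (total R)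
  ; s₁ = cons (s₁ R) ; s₀ = suc ∘ s₀ R
  ; s₁-inj = cons-inj (s₁-inj R)
  ; s₀-inj = s₀-inj R ∘ Finₚ.suc-injective
  ; s₁-in = λ { zero → p ; (suc i) → s₁-in R i } ; s₀-out = s₀-out R
  ; cover = λ { zero → inj₁ p ; (suc t) → map₂ (λ (i , e) → i , cong suc e) (cover R t) } }
  where open Split
... | no ¬p | R = record
  { m₁ = m₁ R ; m₀ = suc (m₀ R) ; total = trans (ℕₚ.+-suc _ _) (cong suc (total R))
  ; s₁ = suc ∘ s₁ R ; s₀ = cons (s₀ R)
  ; s₁-inj = s₁-inj R ∘ Finₚ.suc-injective
  ; s₀-inj = cons-inj (s₀-inj R)
  ; s₁-in = s₁-in R ; s₀-out = λ { zero → ¬p ; (suc i) → s₀-out R i }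
  ; cover = λ { zero → inj₂ (zero , refl)
              ; (suc t) → map₂ (λ (i , e) → suc i , cong suc e) (cover R t) } }
  where open Split

-- Induction on `j`, splitting off the fibre over `zero`. Fibres are tested by injective sequences
-- inside them, because the edge bound for one subgraph of a cover speaks of such sequences of
-- edges.
bounded-fibres : ∀ {T j} B (f : Fin T → Fin j) →
  (∀ i m (s : Fin m → Fin T) → Injective _≡_ _≡_ s → (∀ x → f (s x) ≡ i) → m ≤ B) →
  T ≤ j * B
bounded-fibres {zero}  {j}     B f h = z≤n
bounded-fibres {suc T} {zero}  B f h with () ← f zero
bounded-fibres {suc T} {suc j} B f h = subst (_≤ B + j * B) (total R)
  (ℕₚ.+-mono-≤ (h zero (m₁ R) (s₁ R) (s₁-inj R) (s₁-in R)) (bounded-fibres B f′ h′))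
  where
  open Split
  R = split (λ x → f x Finₚ.≟ zero)
  out : ∀ x → zero ≢ f (s₀ R x)
  out x = s₀-out R x ∘ sym
  f′ : Fin (m₀ R) → Fin j
  f′ x = punchOut (out x)
  h′ : ∀ i m (s : Fin m → Fin (m₀ R)) → Injective _≡_ _≡_ s → (∀ x → f′ (s x) ≡ i) → m ≤ B
  h′ i m s s-inj eq = h (suc i) m (s₀ R ∘ s) (s-inj ∘ s₀-inj R)
    λ x → trans (sym (Finₚ.punchIn-punchOut (out (s x)))) (cong suc (eq x))

complement : ∀ {m E} (s : Fin m → Fin E) → Injective _≡_ _≡_ s →
  ∃ λ (A : List (Fin E)) → m + length A ≤ E × (∀ e → (∃ λ i → s i ≡ e) ⊎ e ∈ A)
complement {m} {E} s s-inj = map (s₀ R) (allFin _) , len , map₂ member ∘ cover R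
  where
  open Split
  R = split (λ e → Finₚ.any? (λ i → s i Finₚ.≟ e))
  member : ∀ {e} → (∃ λ i → s₀ R i ≡ e) → e ∈ map (s₀ R) (allFin _)
  member (i , refl) = ∈-map⁺ (s₀ R) (∈-allFin i)
  both : Fin m ⊎ Fin (m₀ R) → Fin E
  both = [ s , s₀ R ]
  both-inj : Injective _≡_ _≡_ both
  both-inj {inj₁ x} {inj₁ y} e = cong inj₁ (s-inj e)
  both-inj {inj₁ x} {inj₂ y} e = contradiction (x , e) (s₀-out R y)
  both-inj {inj₂ x} {inj₁ y} e = contradiction (y , sym e) (s₀-out R x)
  both-inj {inj₂ x} {inj₂ y} e = cong inj₂ (s₀-inj R e)
  len : m + length (map (s₀ R) (allFin (m₀ R))) ≤ E
  len = subst (λ l → m + l ≤ E)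
    (sym (trans (length-map (s₀ R) (allFin (m₀ R))) (length-tabulate id)))
    (Finₚ.injective⇒≤ {f = both ∘ splitAt m}
      (λ {x} {y} e → trans (sym (Finₚ.join-splitAt m _ x))
        (trans (cong (join m (m₀ R)) (both-inj {splitAt m x} {splitAt m y} e)) (Finₚ.join-splitAt m _ y))))

-- Combinatorial maps

reach-invariant : ∀ {f gs} (Q : Fin f → Set) → (∀ {t x} → t ∈ gs → Q x → Q (t x)) →
  ∀ {x y} → Reach gs x y → Q x → Q y
reach-invariant Q inv here       q = q
reach-invariant Q inv (step t r) q = reach-invariant Q inv r (inv t q)

module MapProperties (M : ProjectivePlaneMap) where
  open ProjectivePlaneMap M public

  Flag : Set
  Flag = Fin flags

  private
    orbit-step : ∀ {gs c} {q : Flag → Fin c} → OrbitMap gs c q → ∀ {t} → t ∈ gs → ∀ x → q (t x) ≡ q x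
    orbit-step (_ , fibres) t∈gs x = sym (Equivalence.from (fibres x _) (step t∈gs here))

  vert-τ₁ : ∀ x → vert (τ₁ x) ≡ vert x
  vert-τ₁ = orbit-step vert-orbits (here refl)

  vert-τ₂ : ∀ x → vert (τ₂ x) ≡ vert x
  vert-τ₂ = orbit-step vert-orbits (there (here refl))

  face-τ₀ : ∀ x → face (τ₀ x) ≡ face x
  face-τ₀ = orbit-step face-orbits (here refl)

  face-τ₁ : ∀ x → face (τ₁ x) ≡ face x
  face-τ₁ = orbit-step face-orbits (there (here refl))

  edge-τ₀ : ∀ x → edge (τ₀ x) ≡ edge x
  edge-τ₀ = orbit-step edge-orbits (here refl)

  edge-τ₂ : ∀ x → edge (τ₂ x) ≡ edge x
  edge-τ₂ = orbit-step edge-orbits (there (here refl))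

  τ₀-invol = proj₁ τ₀-inv
  τ₁-invol = proj₁ τ₁-inv
  τ₂-invol = proj₁ τ₂-inv

  edge-invariant : (Q : Flag → Set) → (∀ {x} → Q x → Q (τ₀ x)) → (∀ {x} → Q x → Q (τ₂ x)) →
    ∀ {x y} → edge x ≡ edge y → Q x → Q y
  edge-invariant Q inv₀ inv₂ e = reach-invariant Q
    (λ { (here refl) → inv₀ ; (there (here refl)) → inv₂ })
    (Equivalence.to (proj₂ edge-orbits _ _) e)

  -- Since `τ₀` and `τ₂` are commuting involutions, an edge has no flags beyond these four. Equality
  -- of edges thereby becomes a case distinction.
  data EdgeFlag (x : Flag) : Flag → Set where
    same  : EdgeFlag x x
    flip₀ : EdgeFlag x (τ₀ x)
    flip₂ : EdgeFlag x (τ₂ x)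
    flip₂₀ : EdgeFlag x (τ₂ (τ₀ x))

  edge-flags : ∀ {x y} → edge x ≡ edge y → EdgeFlag x y
  edge-flags {x} e = edge-invariant (EdgeFlag x) inv₀ inv₂ e same
    where
    inv₀ : ∀ {y} → EdgeFlag x y → EdgeFlag x (τ₀ y)
    inv₀ same   = flip₀
    inv₀ flip₀  = subst (EdgeFlag x) (sym (τ₀-invol x)) same
    inv₀ flip₂  = subst (EdgeFlag x) (sym (τ₀τ₂-comm x)) flip₂₀
    inv₀ flip₂₀ = subst (EdgeFlag x)
      (sym (trans (τ₀τ₂-comm _) (cong τ₂ (τ₀-invol x)))) flip₂
    inv₂ : ∀ {y} → EdgeFlag x y → EdgeFlag x (τ₂ y)
    inv₂ same   = flip₂
    inv₂ flip₀  = flip₂₀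
    inv₂ flip₂  = subst (EdgeFlag x) (sym (τ₂-invol x)) same
    inv₂ flip₂₀ = subst (EdgeFlag x) (sym (τ₂-invol _)) flip₀

  face-onto : ∀ X → ∃ λ x → face x ≡ X
  face-onto X = let x , p = proj₁ face-orbits X in x , p refl

  vert-onto : ∀ v → ∃ λ x → vert x ≡ v
  vert-onto v = let x , p = proj₁ vert-orbits v in x , p refl

  edge-onto : ∀ e → ∃ λ x → edge x ≡ e
  edge-onto e = let x , p = proj₁ edge-orbits e in x , p refl

  Flat : (Fin #V → Bool) → Flag → Set
  Flat g x = g (vert x) ≡ g (vert (τ₀ x))

  flat-τ₀ : ∀ {g x} → Flat g x → Flat g (τ₀ x)
  flat-τ₀ {g} {x} p = trans (sym p) (cong (g ∘ vert) (sym (τ₀-invol x)))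

  flat-τ₂ : ∀ {g x} → Flat g x → Flat g (τ₂ x)
  flat-τ₂ {g} {x} p = trans (cong g (vert-τ₂ x))
    (trans p (cong g (trans (sym (vert-τ₂ (τ₀ x))) (cong vert (sym (τ₀τ₂-comm x))))))

  flat-edge : ∀ {g x y} → edge x ≡ edge y → Flat g x → Flat g y
  flat-edge {g} = edge-invariant (Flat g) (flat-τ₀ {g}) (flat-τ₂ {g})

  face-τ₂τ₀ : ∀ x → face (τ₂ (τ₀ x)) ≡ face (τ₂ x)
  face-τ₂τ₀ x = trans (cong face (sym (τ₀τ₂-comm x))) (face-τ₀ (τ₂ x))

  -- Here `q` sends faces to regions; an edge with one region on both sides belongs to the boundary
  -- of no region.
  OneSided : ∀ {c} → (Fin #F → Fin c) → Flag → Set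
  OneSided q x = q (face x) ≡ q (face (τ₂ x))

  oneSided-τ₀ : ∀ {c} {q : Fin #F → Fin c} {x} → OneSided q x → OneSided q (τ₀ x)
  oneSided-τ₀ {q = q} {x} p = trans (cong q (face-τ₀ x)) (trans p (cong q (sym (face-τ₂τ₀ x))))

  oneSided-τ₂ : ∀ {c} {q : Fin #F → Fin c} {x} → OneSided q x → OneSided q (τ₂ x)
  oneSided-τ₂ {q = q} {x} p = trans (sym p) (cong (q ∘ face) (sym (τ₂-invol x)))

  oneSided-edge : ∀ {c} {q : Fin #F → Fin c} {x y} → edge x ≡ edge y → OneSided q x → OneSided q y
  oneSided-edge {q = q} = edge-invariant (OneSided q) (oneSided-τ₀ {q = q}) (oneSided-τ₂ {q = q})

  -- An involution whose fixed flags are those satisfying neither Φ nor Ψ. Played off against the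
  -- fixed-point-free τ₁, it shows that these are even in number on any set of flags closed under both.
  module Matching {Φ Ψ : Pred Flag 0ℓ} (Φ? : Decidable Φ) (Ψ? : Decidable Ψ)
    (Φ-τ₀ : ∀ {x} → Φ x → Φ (τ₀ x)) (Φ-τ₂ : ∀ {x} → Φ x → Φ (τ₂ x))
    (Ψ-τ₂ : ∀ {x} → Ψ x → Ψ (τ₂ x)) where

    ρ : Flag → Flag
    ρ x with Φ? x | Ψ? x
    ... | yes _ | _     = τ₀ x
    ... | no _  | yes _ = τ₂ x
    ... | no _  | no _  = x

    data ρ-Case (x : Flag) : Flag → Set where
      by-τ₀   : Φ x → ρ-Case x (τ₀ x)
      by-τ₂   : ¬ Φ x → Ψ x → ρ-Case x (τ₂ x)
      unmoved : ¬ Φ x → ¬ Ψ x → ρ-Case x x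

    ρ-case : ∀ x → ρ-Case x (ρ x)
    ρ-case x with Φ? x | Ψ? x
    ... | yes p | _     = by-τ₀ p
    ... | no ¬p | yes p = by-τ₂ ¬p p
    ... | no ¬p | no ¬q = unmoved ¬p ¬q

    ρ-unmoved : ∀ {x} → ¬ Φ x → ¬ Ψ x → ρ x ≡ x
    ρ-unmoved {x} ¬p ¬q with Φ? x | Ψ? x
    ... | yes p | _     = contradiction p ¬p
    ... | no _  | yes q = contradiction q ¬q
    ... | no _  | no _  = refl

    ρ-fixed : ∀ {x} → ρ x ≡ x → ¬ Φ x × ¬ Ψ x
    ρ-fixed {x} e with ρ x | ρ-case x
    ... | _ | by-τ₀ _     = contradiction e (proj₂ τ₀-inv x)
    ... | _ | by-τ₂ _ _   = contradiction e (proj₂ τ₂-inv x)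
    ... | _ | unmoved p q = p , q

    ρ-invol : ∀ x → ρ (ρ x) ≡ x
    ρ-invol x with ρ x | ρ-case x
    ... | _ | unmoved p q = ρ-unmoved p q
    ... | _ | by-τ₀ p with ρ (τ₀ x) | ρ-case (τ₀ x)
    ...   | _ | by-τ₀ _     = τ₀-invol x
    ...   | _ | by-τ₂ ¬p _  = contradiction (Φ-τ₀ p) ¬p
    ...   | _ | unmoved ¬p _ = contradiction (Φ-τ₀ p) ¬p
    ρ-invol x | _ | by-τ₂ ¬p q with ρ (τ₂ x) | ρ-case (τ₂ x)
    ...   | _ | by-τ₀ p = contradiction (subst Φ (τ₂-invol x) (Φ-τ₂ p)) ¬p
    ...   | _ | by-τ₂ _ _ = τ₂-invol x
    ...   | _ | unmoved _ ¬q = contradiction (Ψ-τ₂ q) ¬q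

    ρ-closed : ∀ {A : Flag → Set} → (∀ {x} → Φ x → A x → A (τ₀ x)) → (∀ {x} → Ψ x → A x → A (τ₂ x)) →
      ∀ {x} → A x → A (ρ x)
    ρ-closed c₀ c₂ {x} a with ρ x | ρ-case x
    ... | _ | by-τ₀ p     = c₀ p a
    ... | _ | by-τ₂ _ q   = c₂ q a
    ... | _ | unmoved _ _ = a

  -- The edge crossed from X to another region is the only one of the region X at which g can
  -- change, while along the boundary of X the number of changes is even.
  flat-at-crossing : ∀ {c} (q : Fin #F → Fin c) (g : Fin #V → Bool) {x} →
    ¬ OneSided q x → (∀ y → edge x ≡ edge y ⊎ OneSided q y ⊎ Flat g y) → Flat g x
  flat-at-crossing q g {x} cross others with g (vert x) Boolₚ.≟ g (vert (τ₀ x))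
  ... | yes flat = flat
  ... | no ¬flat = ⊥-elim (orient (g (vert x)) refl)
    where
    open Matching {Flat g} {OneSided q} (λ y → _ Boolₚ.≟ _) (λ y → _ Finₚ.≟ _)
      (flat-τ₀ {g}) (flat-τ₂ {g}) (oneSided-τ₂ {q = q})
    impossible : ∀ x → g (vert x) ≡ true → ¬ Flat g x → ¬ OneSided q x →
      (∀ y → edge x ≡ edge y ⊎ OneSided q y ⊎ Flat g y) → ⊥
    impossible x gx ¬flat cross others = analyse
      (second-fixed-point {A = A} (λ y → (_ Finₚ.≟ _) ×-dec (_ Boolₚ.≟ _))
        τ₁-invol (proj₂ τ₁-inv)
        (λ {y} (a , b) → trans (cong q (face-τ₁ y)) a , trans (cong g (vert-τ₁ y)) b)
        ρ-invol
        (ρ-closed {A} (λ {y} p (a , b) → trans (cong q (face-τ₀ y)) a , trans (sym p) b)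
                  (λ {y} p (a , b) → trans (sym p) a , trans (cong g (vert-τ₂ y)) b))
        (refl , gx) (ρ-unmoved ¬flat cross))
      where
      A : Flag → Set
      -- An edge with differently coloured ends and only one side in this region has exactly one
      -- flag in `A`. The fixed points of `ρ` in `A` thus count the colour changes along the
      -- boundary of the region.
      A y = q (face y) ≡ q (face x) × g (vert y) ≡ true
      analyse : ¬ ∃ λ y → y ≢ x × A y × ρ y ≡ y
      analyse (y , y≢x , (qy , gy) , fix) with others y
      ... | inj₂ (inj₁ s) = proj₂ (ρ-fixed fix) s
      ... | inj₂ (inj₂ p) = proj₁ (ρ-fixed fix) p
      ... | inj₁ e with edge-flags e
      ...   | same   = y≢x refl
      ...   | flip₀  = ¬flat (trans gx (sym gy))
      ...   | flip₂  = cross (sym qy)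
      ...   | flip₂₀ = ¬flat (trans gx (trans (sym gy) (cong g (vert-τ₂ _))))
    orient : ∀ b → g (vert x) ≡ b → ⊥
    orient true  gx = impossible x gx ¬flat cross others
    orient false gx = impossible (τ₀ x)
      (Boolₚ.¬-not λ p → ¬flat (trans gx (sym p)))
      (λ p → ¬flat (subst (Flat g) (τ₀-invol x) (flat-τ₀ {g} p)))
      (λ p → cross (subst (OneSided q) (τ₀-invol x) (oneSided-τ₀ {q = q} p)))
      (λ y → map₁ (trans (edge-τ₀ x)) (others y))

  -- The edges of A that merged two regions are those of a forest in the dual graph; uncut holds one
  -- flag of each other edge of A. The field flat says that deleting the forest leaves the map
  -- connected, in terms of 2-colourings of the vertices.
  record DualForest (A : List (Fin #E)) : Set where
    field
      regions : ℕ
      region  : Fin #F → Fin regions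
      onto    : ∀ X → ∃ λ F → region F ≡ X
      uncut   : List Flag
      count   : #F + length uncut ≡ regions + length A
      merged  : ∀ {x} → edge x ∈ A → OneSided region x
      flat    : ∀ g → (∀ {x} → x ∈ uncut → Flat g x) →
                (∀ x → edge x ∈ A ⊎ Flat g x) → ∀ x → Flat g x

  -- An edge with one region already on both sides closes a cycle in the dual graph and goes to
  -- `uncut`; any other edge merges its two regions. In the first case both sides of `count` grow by
  -- one, in the second neither changes.
  dualForest : ∀ A → DualForest A
  dualForest [] = record
    { regions = #F ; region = id ; onto = λ F → F , refl ; uncut = [] ; count = refl
    ; merged = λ () ; flat = λ { g _ h x → [ (λ ()) , id ] (h x) } }
  dualForest (e ∷ A) = extend (regions D) (region D) (onto D) (count D) (merged D) (flat D)
    where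
    open DualForest
    D = dualForest A
    K = uncut D
    x₀ = proj₁ (edge-onto e)
    e₀ : edge x₀ ≡ e
    e₀ = proj₂ (edge-onto e)
    extend : ∀ c (q : Fin #F → Fin c) → (∀ X → ∃ λ F → q F ≡ X) → #F + length K ≡ c + length A →
      (∀ {x} → edge x ∈ A → OneSided q x) →
      (∀ g → (∀ {x} → x ∈ K → Flat g x) → (∀ x → edge x ∈ A ⊎ Flat g x) → ∀ x → Flat g x) →
      DualForest (e ∷ A)
    extend c q onto count merged flat with q (face x₀) Finₚ.≟ q (face (τ₂ x₀))
    ... | yes s = record
      { regions = c ; region = q ; onto = onto ; uncut = x₀ ∷ K
      ; count = trans (ℕₚ.+-suc #F _) (trans (cong suc count) (sym (ℕₚ.+-suc c _)))
      ; merged = λ { (here p) → oneSided-edge {q = q} (trans e₀ (sym p)) s ; (there p) → merged p }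
      ; flat = λ g k h → flat g (k ∘ there) λ x → rest g (k (here refl)) (h x) }
      where
      rest : ∀ g → Flat g x₀ → ∀ {x} → edge x ∈ (e ∷ A) ⊎ Flat g x → edge x ∈ A ⊎ Flat g x
      rest g f (inj₁ (here p))  = inj₂ (flat-edge {g} (trans e₀ (sym p)) f)
      rest g f (inj₁ (there p)) = inj₁ p
      rest g f (inj₂ p)         = inj₂ p
    extend zero q onto count merged flat | no _ = contradiction (q (face x₀)) λ ()
    extend (suc c) q onto count merged flat | no cross = record
      { regions = c ; region = merge cross ∘ q
      ; onto = λ X → let y , p = merge-surjective cross X ; F , r = onto y
                     in F , trans (cong (merge cross) r) p
      ; uncut = K
      ; count = trans count (sym (ℕₚ.+-suc c _))
      ; merged = λ { (here p) → oneSided-edge {q = merge cross ∘ q} (trans e₀ (sym p)) (merge-collapses cross)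
                   ; (there p) → cong (merge cross) (merged p) }
      ; flat = λ g k h → flat g k λ x → rest g h (h x) }
      where
      classify : ∀ {g x} → edge x ∈ (e ∷ A) ⊎ Flat g x → edge x₀ ≡ edge x ⊎ OneSided q x ⊎ Flat g x
      classify (inj₁ (here p))  = inj₁ (trans e₀ (sym p))
      classify (inj₁ (there p)) = inj₂ (inj₁ (merged p))
      classify (inj₂ p)         = inj₂ (inj₂ p)
      rest : ∀ g → (∀ x → edge x ∈ (e ∷ A) ⊎ Flat g x) →
        ∀ {x} → edge x ∈ (e ∷ A) ⊎ Flat g x → edge x ∈ A ⊎ Flat g x
      -- Before the merge every edge of `A` has a single region on both sides, and every edge
      -- outside `e ∷ A` is flat by hypothesis, so `e` is the one exception that `flat-at-crossing`
      -- permits.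
      rest g h (inj₁ (here p))  =
        inj₂ (flat-edge {g} (trans e₀ (sym p)) (flat-at-crossing q g cross (classify {g} ∘ h)))
      rest g h (inj₁ (there p)) = inj₁ p
      rest g h (inj₂ p)         = inj₂ p

-- Triangle-free subgraphs of projective planar maps

four-injective : ∀ {A : Set} (w : Fin 4 → A) →
  w zero ≢ w (suc zero) → w zero ≢ w (suc (suc zero)) → w zero ≢ w (suc (suc (suc zero))) →
  w (suc zero) ≢ w (suc (suc zero)) → w (suc zero) ≢ w (suc (suc (suc zero))) →
  w (suc (suc zero)) ≢ w (suc (suc (suc zero))) → Injective _≡_ _≡_ w
four-injective w a b c d e f {zero} {zero} p = refl
four-injective w a b c d e f {zero} {suc zero} p = contradiction p a
four-injective w a b c d e f {zero} {suc (suc zero)} p = contradiction p b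
four-injective w a b c d e f {zero} {suc (suc (suc zero))} p = contradiction p c
four-injective w a b c d e f {suc zero} {zero} p = contradiction (sym p) a
four-injective w a b c d e f {suc zero} {suc zero} p = refl
four-injective w a b c d e f {suc zero} {suc (suc zero)} p = contradiction p d
four-injective w a b c d e f {suc zero} {suc (suc (suc zero))} p = contradiction p e
four-injective w a b c d e f {suc (suc zero)} {zero} p = contradiction (sym p) b
four-injective w a b c d e f {suc (suc zero)} {suc zero} p = contradiction (sym p) d
four-injective w a b c d e f {suc (suc zero)} {suc (suc zero)} p = refl
four-injective w a b c d e f {suc (suc zero)} {suc (suc (suc zero))} p = contradiction p f
four-injective w a b c d e f {suc (suc (suc zero))} {zero} p = contradiction (sym p) c
four-injective w a b c d e f {suc (suc (suc zero))} {suc zero} p = contradiction (sym p) e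
four-injective w a b c d e f {suc (suc (suc zero))} {suc (suc zero)} p = contradiction (sym p) f
four-injective w a b c d e f {suc (suc (suc zero))} {suc (suc (suc zero))} p = refl

product-injective⇒≤ : ∀ {a b c d} {f : Fin a × Fin b → Fin c × Fin d} →
  Injective _≡_ _≡_ f → a * b ≤ c * d
product-injective⇒≤ {a} {b} {c} {d} {f} f-inj = Finₚ.injective⇒≤
  {f = λ x → combine (proj₁ (f (remQuot b x))) (proj₂ (f (remQuot b x)))} λ {x} {y} e →
    trans (sym (Finₚ.combine-remQuot {a} b x))
      (trans (cong (λ p → combine (proj₁ p) (proj₂ p)) (f-inj (cong₂ _,_
               (Finₚ.combine-injectiveˡ _ _ _ _ e) (Finₚ.combine-injectiveʳ {c} {d} _ _ _ _ e))))
        (Finₚ.combine-remQuot {a} b y))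

-- The map may have loops and parallel edges while the subgraph has neither. The subgraph is
-- therefore given by one flag `s i` per edge, and simplicity is stated below as injectivity of `s`
-- up to having the same pair of ends.
module TriangleFreeSubgraph (M : ProjectivePlaneMap)
  (R : Rel (Fin (ProjectivePlaneMap.#V M)))
  (R-sym : ∀ {a b} → R a b → R b a)
  (R-irrefl : ∀ {a} → ¬ R a a)
  (R-triangle-free : ∀ {a b c} → R a b → R b c → R c a → ⊥)
  {m} (s : Fin m → Fin (ProjectivePlaneMap.flags M)) where

  open MapProperties M

  data SameEnds (x y : Flag) : Set where
    aligned : vert x ≡ vert y → vert (τ₀ x) ≡ vert (τ₀ y) → SameEnds x y
    reversed : vert x ≡ vert (τ₀ y) → vert (τ₀ x) ≡ vert y → SameEnds x y

  sameEnds-sym : ∀ {x y} → SameEnds x y → SameEnds y x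
  sameEnds-sym (aligned p q) = aligned (sym p) (sym q)
  sameEnds-sym (reversed p q) = reversed (sym q) (sym p)

  sameEnds-trans : ∀ {x y z} → SameEnds x y → SameEnds y z → SameEnds x z
  sameEnds-trans (aligned p q) (aligned r t) = aligned (trans p r) (trans q t)
  sameEnds-trans (aligned p q) (reversed r t) = reversed (trans p r) (trans q t)
  sameEnds-trans (reversed p q) (aligned r t) = reversed (trans p t) (trans q r)
  sameEnds-trans (reversed p q) (reversed r t) = aligned (trans p t) (trans q r)

  vert-τ₀τ₂ : ∀ x → vert (τ₀ (τ₂ x)) ≡ vert (τ₀ x)
  vert-τ₀τ₂ x = trans (cong vert (τ₀τ₂-comm x)) (vert-τ₂ (τ₀ x))

  edge⇒sameEnds : ∀ {x y} → edge x ≡ edge y → SameEnds x y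
  edge⇒sameEnds e with edge-flags e
  ... | same   = aligned refl refl
  ... | flip₀  = reversed (cong vert (sym (τ₀-invol _))) refl
  ... | flip₂  = aligned (sym (vert-τ₂ _)) (sym (vert-τ₀τ₂ _))
  ... | flip₂₀ = reversed (sym (trans (vert-τ₀τ₂ _) (cong vert (τ₀-invol _)))) (sym (vert-τ₂ _))

  module _ (s-R : ∀ i → R (vert (s i)) (vert (τ₀ (s i))))
           (s-simple : ∀ {i j} → SameEnds (s i) (s j) → i ≡ j) where

    edge∘s-injective : Injective _≡_ _≡_ (edge ∘ s)
    edge∘s-injective e = s-simple (edge⇒sameEnds e)

    Chosen : Flag → Set
    Chosen x = ∃ λ i → edge (s i) ≡ edge x

    chosen-R : ∀ {x} → Chosen x → R (vert x) (vert (τ₀ x))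
    chosen-R {x} (i , e) with edge⇒sameEnds e
    ... | aligned p q = subst₂ R p q (s-R i)
    ... | reversed p q = subst₂ R q p (R-sym (s-R i))

    chosen-simple : ∀ {x y} → Chosen x → Chosen y → SameEnds x y → edge x ≡ edge y
    chosen-simple (i , e) (j , f) h = trans (sym e) (trans (cong (edge ∘ s) i≡j) f)
      where
      i≡j = s-simple (sameEnds-trans (edge⇒sameEnds e) (sameEnds-trans h (sameEnds-sym (edge⇒sameEnds f))))

    module _ {c} (q : Fin #F → Fin c) (q-onto : ∀ X → ∃ λ F → q F ≡ X)
             (two-sided : ∀ x → Chosen x ⊎ OneSided q x) where

      record Boundary (X : Fin c) (x : Flag) : Set where
        constructor bd
        field
          inside  : q (face x) ≡ X
          outside : q (face (τ₂ x)) ≢ X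

      boundary-chosen : ∀ {X x} → Boundary X x → Chosen x
      boundary-chosen {x = x} (bd i o) with two-sided x
      ... | inj₁ p = p
      ... | inj₂ p = contradiction (trans (sym p) i) o

      boundary-τ₀ : ∀ {X x} → Boundary X x → Boundary X (τ₀ x)
      boundary-τ₀ {x = x} (bd i o) =
        bd (trans (cong q (face-τ₀ x)) i) (o ∘ trans (cong q (sym (face-τ₂τ₀ x))))

      boundary-loopless : ∀ {X x} → Boundary X x → vert x ≢ vert (τ₀ x)
      boundary-loopless {x = x} b e = R-irrefl (subst (R (vert x)) (sym e) (chosen-R (boundary-chosen b)))

      -- The boundary of a region is even at each vertex: among the flags of the region at that
      -- vertex, `τ₁` fixes none, while `ρ`, which here only crosses one-sided edges, fixes exactly
      -- the boundary flags. The second one lies on another edge, as boundary edges are no loops and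
      -- have their other side outside the region.
      boundary-next : ∀ {X x} → Boundary X x →
        ∃ λ y → Boundary X y × vert y ≡ vert x × edge y ≢ edge x
      boundary-next {X} {x} b@(bd i o) = analyse
        (second-fixed-point {A = A} (λ y → (_ Finₚ.≟ _) ×-dec (_ Finₚ.≟ _))
          τ₁-invol (proj₂ τ₁-inv)
          (λ {y} (v , f) → trans (vert-τ₁ y) v , trans (cong q (face-τ₁ y)) f)
          ρ-invol
          (ρ-closed {A} (λ ()) (λ {y} p (v , f) → trans (vert-τ₂ y) v , trans (sym p) f))
          (refl , i) (ρ-unmoved (λ ()) (λ p → o (trans (sym p) i))))
        where
        open Matching {λ _ → ⊥} {OneSided q} (λ _ → no λ ()) (λ y → _ Finₚ.≟ _)
          (λ ()) (λ ()) (oneSided-τ₂ {q = q})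
        A : Flag → Set
        A y = vert y ≡ vert x × q (face y) ≡ X
        analyse : (∃ λ y → y ≢ x × A y × ρ y ≡ y) →
                  ∃ λ y → Boundary X y × vert y ≡ vert x × edge y ≢ edge x
        analyse (y , y≢x , (v , f) , fix) =
          y , bd f (λ p → proj₂ (ρ-fixed fix) (trans f (sym p))) , v , other
          where
          other : edge y ≢ edge x
          other e with edge-flags (sym e)
          ... | same   = y≢x refl
          ... | flip₀  = boundary-loopless b (sym v)
          ... | flip₂  = o f
          ... | flip₂₀ = boundary-loopless b (trans (sym v) (vert-τ₂ _))

      -- Along a walk through the flags only `τ₂` can change the region, so the first exit from the
      -- region takes place at a boundary flag.
      crossing : ∀ {X x y} → Reach (τ₀ ∷ τ₁ ∷ τ₂ ∷ []) x y →
        q (face x) ≡ X → q (face y) ≢ X → ∃ (Boundary X)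
      crossing here p r = contradiction p r
      crossing {x = x} (step (here refl) w) p r = crossing w (trans (cong q (face-τ₀ x)) p) r
      crossing {x = x} (step (there (here refl)) w) p r = crossing w (trans (cong q (face-τ₁ x)) p) r
      crossing {X} {x} (step (there (there (here refl))) w) p r with q (face (τ₂ x)) Finₚ.≟ X
      ... | yes p′ = crossing w p′ r
      ... | no ¬p′ = x , bd p ¬p′

      boundary-nonempty : ∀ {X Y} → Y ≢ X → ∃ (Boundary X)
      boundary-nonempty {X} {Y} Y≢X =
        let F , p = q-onto X ; G , r = q-onto Y
            x , fx = face-onto F ; y , fy = face-onto G
        in crossing (connected x y) (trans (cong q fx) p)
                    (λ e → Y≢X (trans (sym (trans (cong q fy) r)) e))

      -- Let `x` be the edge ab and `y` the edge ac, with `z` leaving b and `u` leaving c. An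
      -- equality of `x` with `u` or of `y` with `z` would give a loop or make `x` and `y` parallel;
      -- an equality of `z` with `u` would either do the latter or close the triangle abc.
      four-distinct : ∀ {X x y z u} → Boundary X x → Boundary X y → Boundary X z → Boundary X u →
        vert y ≡ vert x → edge y ≢ edge x → vert z ≡ vert (τ₀ x) → edge z ≢ edge (τ₀ x) →
        vert u ≡ vert (τ₀ y) → edge u ≢ edge (τ₀ y) →
        ∃ λ (w : Fin 4 → Flag) → (∀ t → Boundary X (w t)) × Injective _≡_ _≡_ (edge ∘ w)
      four-distinct {X} {x} {y} {z} {u} bx by bz bu vy ey vz ez vu eu =
        w , bw , four-injective (edge ∘ w)
          (ey ∘ sym)
          (λ e → ez (trans (sym e) (sym (edge-τ₀ x))))
          x≢u y≢z
          (λ e → eu (trans (sym e) (sym (edge-τ₀ y))))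
          z≢u
        where
        w : Fin 4 → Flag
        w zero = x
        w (suc zero) = y
        w (suc (suc zero)) = z
        w (suc (suc (suc zero))) = u
        bw : ∀ t → Boundary X (w t)
        bw zero = bx
        bw (suc zero) = by
        bw (suc (suc zero)) = bz
        bw (suc (suc (suc zero))) = bu
        no-parallel : vert (τ₀ x) ≢ vert (τ₀ y)
        no-parallel p = ey (sym (chosen-simple (boundary-chosen bx) (boundary-chosen by) (aligned (sym vy) p)))
        loopy : vert (τ₀ y) ≢ vert x
        loopy p = boundary-loopless by (trans vy (sym p))
        x≢u : edge x ≢ edge u
        x≢u e with edge⇒sameEnds e
        ... | aligned p _ = loopy (trans (sym vu) (sym p))
        ... | reversed _ p = no-parallel (trans p vu)
        y≢z : edge y ≢ edge z
        y≢z e with edge⇒sameEnds e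
        ... | aligned p _ = boundary-loopless bx (trans (sym vy) (trans p vz))
        ... | reversed _ p = no-parallel (sym (trans p vz))
        z≢u : edge z ≢ edge u
        z≢u e with edge⇒sameEnds e
        ... | aligned p _ = no-parallel (trans (sym vz) (trans p vu))
        ... | reversed _ p = R-triangle-free (chosen-R (boundary-chosen bx))
          (subst₂ R vz (trans p vu) (chosen-R (boundary-chosen bz)))
          (subst (R (vert (τ₀ y))) vy (R-sym (chosen-R (boundary-chosen by))))

      four-boundary-edges : ∀ {X} → ∃ (Boundary X) →
        ∃ λ (w : Fin 4 → Flag) → (∀ t → Boundary X (w t)) × Injective _≡_ _≡_ (edge ∘ w)
      four-boundary-edges (x , bx) =
        let y , by , vy , ey = boundary-next bx
            z , bz , vz , ez = boundary-next (boundary-τ₀ bx)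
            u , bu , vu , eu = boundary-next (boundary-τ₀ by)
        in four-distinct bx by bz bu vy ey vz ez vu eu

      side : Fin m × Fin 2 → Fin c
      side (i , zero)     = q (face (s i))
      side (i , suc zero) = q (face (τ₂ (s i)))

      on-side : ∀ {X x} → Boundary X x → ∃ λ i → edge (s i) ≡ edge x × ∃ λ b → side (i , b) ≡ X
      on-side {X} b@(bd inside _) with boundary-chosen b
      ... | i , e with edge-flags e
      ... | same   = i , refl , zero , inside
      ... | flip₀  = i , sym (edge-τ₀ _) , zero , trans (cong q (sym (face-τ₀ _))) inside
      ... | flip₂  = i , sym (edge-τ₂ _) , suc zero , inside
      ... | flip₂₀ = i , e , suc zero , trans (cong q (sym (face-τ₂τ₀ _))) inside

      module _ (w : Fin c → Fin 4 → Flag) (w-injective : ∀ X → Injective _≡_ _≡_ (edge ∘ w X))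
               (located : ∀ X t → ∃ λ i → edge (s i) ≡ edge (w X t) × ∃ λ b → side (i , b) ≡ X) where

        place : Fin c × Fin 4 → Fin m × Fin 2
        place (X , t) = proj₁ (located X t) , proj₁ (proj₂ (proj₂ (located X t)))

        side-place : ∀ X t → side (place (X , t)) ≡ X
        side-place X t = proj₂ (proj₂ (proj₂ (located X t)))

        place-injective : Injective _≡_ _≡_ place
        place-injective {X , t} {Y , u} e
          with refl ← trans (sym (side-place X t)) (trans (cong side e) (side-place Y u))
          = cong (X ,_) (w-injective X
              (trans (sym (proj₁ (proj₂ (located X t))))
                (trans (cong (edge ∘ s ∘ proj₁) e) (proj₁ (proj₂ (located X u))))))

      -- The m edges have 2m sides. Every region claims one side of each of its four boundary edges;
      -- a side knows its region, so no side is claimed by two regions.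
      four-edges-per-region : (∀ X → ∃ λ Y → Y ≢ X) → c * 4 ≤ m * 2
      four-edges-per-region others = product-injective⇒≤
        (place-injective (proj₁ ∘ chosen) (proj₂ ∘ proj₂ ∘ chosen)
          (λ X t → on-side (proj₁ (proj₂ (chosen X)) t)))
        where
        chosen : ∀ X → ∃ λ (w : Fin 4 → Flag) → (∀ t → Boundary X (w t)) × Injective _≡_ _≡_ (edge ∘ w)
        chosen X = four-boundary-edges (boundary-nonempty (proj₂ (others X)))

    module _ (v₀ : Fin #V) (vs : List (Fin #V))
             (s-in : ∀ i → vert (s i) ∈ (v₀ ∷ vs) × vert (τ₀ (s i)) ∈ (v₀ ∷ vs)) where

      private
        C = complement (edge ∘ s) edge∘s-injective
        A = proj₁ C
        open DualForest (dualForest A)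

        -- Besides the uncut edges, all vertices of the subgraph are identified with v₀.
        gluing : List (Fin #V × Fin #V)
        gluing = map (λ x → vert x , vert (τ₀ x)) uncut ++ map (v₀ ,_) vs

      -- The 2-colouring is membership in the class `u`. Chosen edges are flat because both ends are
      -- glued to `v₀`, uncut edges because their ends are glued to each other, and the dual forest
      -- extends flatness to the remaining deleted edges.
      glued-flat : ∀ {c} (q : Fin #V → Fin c) → (∀ {a b} → (a , b) ∈ gluing → q a ≡ q b) →
        ∀ u → ∀ x → does (q (vert x) Finₚ.≟ u) ≡ does (q (vert (τ₀ x)) Finₚ.≟ u)
      glued-flat q glued u = flat (λ v → does (q v Finₚ.≟ u))
        (λ x∈K → cong (λ y → does (y Finₚ.≟ u)) (glued (∈-++⁺ˡ (∈-map⁺ _ x∈K))))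
        λ x → cover′ (proj₂ (proj₂ C) (edge x))
        where
        centre : ∀ {v} → v ∈ (v₀ ∷ vs) → q v₀ ≡ q v
        centre (here refl) = refl
        centre (there p)   = glued (∈-++⁺ʳ (map _ uncut) (∈-map⁺ (v₀ ,_) p))
        cover′ : ∀ {x} → (∃ λ i → edge (s i) ≡ edge x) ⊎ edge x ∈ A →
          edge x ∈ A ⊎ Flat (λ v → does (q v Finₚ.≟ u)) x
        cover′ (inj₂ p) = inj₁ p
        cover′ {x} (inj₁ (i , e)) = inj₂ (flat-edge {λ v → does (q v Finₚ.≟ u)} e
          (cong (λ y → does (y Finₚ.≟ u))
            (trans (sym (centre (proj₁ (s-in i)))) (centre (proj₂ (s-in i))))))

      one-class : ∀ {c} (q : Fin #V → Fin c) → (∀ {a b} → (a , b) ∈ gluing → q a ≡ q b) →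
        ∀ u v → q u ≡ q v
      one-class q glued u v = decide
        where
        X = vert-onto u
        Y = vert-onto v
        constant : does (q (vert (proj₁ X)) Finₚ.≟ q u) ≡ does (q (vert (proj₁ Y)) Finₚ.≟ q u)
        constant = reach-invariant (λ y → does (q (vert (proj₁ X)) Finₚ.≟ q u) ≡ does (q (vert y) Finₚ.≟ q u))
          (λ { {x = x} (here refl) p → trans p (glued-flat q glued (q u) x)
             ; {x = x} (there (here refl)) p →
                 trans p (cong (λ y → does (q y Finₚ.≟ q u)) (sym (vert-τ₁ x)))
             ; {x = x} (there (there (here refl))) p →
                 trans p (cong (λ y → does (q y Finₚ.≟ q u)) (sym (vert-τ₂ x))) })
          (connected (proj₁ X) (proj₁ Y)) refl
        decide : q u ≡ q v
        decide with q v Finₚ.≟ q u | subst₂ (λ a b → does (q a Finₚ.≟ q u) ≡ does (q b Finₚ.≟ q u)) (proj₂ X) (proj₂ Y) constant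
        ... | yes p | _ = sym p
        ... | no _ | k rewrite dec-true (q u Finₚ.≟ q u) refl with () ← k

      vertex-bound : #V ≤ 1 + (length uncut + length vs)
      vertex-bound = ℕₚ.≤-trans bound (ℕₚ.+-mono-≤ few (ℕₚ.≤-reflexive len))
        where
        open Quotient (quotient #V gluing)
        len : length gluing ≡ length uncut + length vs
        len = trans (length-++ (map _ uncut)) (cong₂ _+_ (length-map _ uncut) (length-map _ vs))
        few : classes ≤ 1
        few = Finₚ.injective⇒≤ {f = λ _ → zero} λ {x} {y} _ →
          let u , p = onto-class x ; v , r = onto-class y
          in trans (sym p) (trans (one-class class glued u v) r)
          where onto-class = Quotient.onto (quotient #V gluing)

      -- Euler's formula as an inequality for the subgraph: combine #E ≥ m + deleted, #V ≤ 1 + uncut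
      -- + (N - 1) and #F + uncut = regions + deleted with #V + #F = #E + 1; the uncut and deleted
      -- edges cancel.
      region-bound : m + 1 ≤ regions + (1 + length vs)
      region-bound = ℕₚ.+-cancelʳ-≤ (length A) _ _ (begin
        m + 1 + length A                       ≡⟨ shuffle₁ m (length A) ⟩
        m + length A + 1                       ≤⟨ ℕₚ.+-monoˡ-≤ 1 (proj₁ (proj₂ C)) ⟩
        #E + 1                                 ≡⟨ sym euler ⟩
        #V + #F                                ≤⟨ ℕₚ.+-monoˡ-≤ #F vertex-bound ⟩
        1 + (length uncut + length vs) + #F    ≡⟨ shuffle₂ (length uncut) (length vs) #F ⟩
        #F + length uncut + (1 + length vs)    ≡⟨ cong (_+ (1 + length vs)) count ⟩
        regions + length A + (1 + length vs)   ≡⟨ shuffle₃ regions (length A) (length vs) ⟩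
        regions + (1 + length vs) + length A   ∎)
        where
        open ℕₚ.≤-Reasoning
        shuffle₁ : ∀ m a → m + 1 + a ≡ m + a + 1
        shuffle₁ = solve-∀
        shuffle₂ : ∀ k v f → 1 + (k + v) + f ≡ f + k + (1 + v)
        shuffle₂ = solve-∀
        shuffle₃ : ∀ c a v → c + a + (1 + v) ≡ c + (1 + v) + a
        shuffle₃ = solve-∀

      two-sided : ∀ x → Chosen x ⊎ OneSided region x
      two-sided x = map₂ merged (proj₂ (proj₂ C) (edge x))

      edge-bound : 1 ≤ length vs → m + 2 ≤ (1 + length vs) * 2
      edge-bound 1≤ = go regions region onto two-sided region-bound
        where
        open ℕₚ.≤-Reasoning
        N = 1 + length vs
        -- A single region may have an empty boundary, so no face count is available; but then m ≤
        -- N, and N ≥ 2 suffices.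
        few : ∀ c → c ≤ 1 → m + 1 ≤ c + N → m + 2 ≤ N * 2
        few c c≤1 h = begin
          m + 2        ≡⟨ sym (ℕₚ.+-assoc m 1 1) ⟩
          m + 1 + 1    ≤⟨ ℕₚ.+-monoˡ-≤ 1 h ⟩
          c + N + 1    ≤⟨ ℕₚ.+-mono-≤ (ℕₚ.+-monoˡ-≤ N c≤1) 1≤ ⟩
          1 + N + length vs   ≡⟨ double (length vs) ⟩
          N * 2        ∎
          where
          double : ∀ l → 1 + (1 + l) + l ≡ (1 + l) * 2
          double = solve-∀
        go : ∀ c (q : Fin #F → Fin c) → (∀ X → ∃ λ F → q F ≡ X) →
          (∀ x → Chosen x ⊎ OneSided q x) → m + 1 ≤ c + N → m + 2 ≤ N * 2
        go zero q onto ts = few 0 z≤n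
        go (suc zero) q onto ts = few 1 ℕₚ.≤-refl
        -- With 2c ≤ m, doubling m + 1 ≤ c + N gives 2m + 2 ≤ m + 2N.
        go c@(suc (suc c′)) q onto ts h = ℕₚ.+-cancelˡ-≤ m _ _ (begin
          m + (m + 2)       ≡⟨ shuffle₁ m ⟩
          (m + 1) * 2       ≤⟨ ℕₚ.*-monoˡ-≤ 2 h ⟩
          (c + N) * 2       ≡⟨ ℕₚ.*-distribʳ-+ 2 c N ⟩
          c * 2 + N * 2     ≤⟨ ℕₚ.+-monoˡ-≤ (N * 2) half ⟩
          m + N * 2         ∎)
          where
          shuffle₁ : ∀ m → m + (m + 2) ≡ (m + 1) * 2
          shuffle₁ = solve-∀
          half : c * 2 ≤ m
          half = ℕₚ.*-cancelʳ-≤ (c * 2) m 2 (subst (_≤ m * 2) (sym (ℕₚ.*-assoc c 2 2))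
            (four-edges-per-region q onto ts (λ X → punchIn X zero , Finₚ.punchInᵢ≢i X zero)))

-- A projective grid

-- The counterpart of `Reach` on an arbitrary type: the grid is studied with structured flags and
-- transported to `Fin` only at the end, by `Numbering`.
data Orbit {A : Set} (gs : List (A → A)) : A → A → Set where
  here : ∀ {x} → Orbit gs x x
  step : ∀ {x y t} → t ∈ gs → Orbit gs (t x) y → Orbit gs x y

module _ {A : Set} {gs : List (A → A)} where

  orbit-trans : ∀ {x y z} → Orbit gs x y → Orbit gs y z → Orbit gs x z
  orbit-trans here       r = r
  orbit-trans (step t q) r = step t (orbit-trans q r)

  orbit-sym : (∀ {t} → t ∈ gs → ∀ x → t (t x) ≡ x) → ∀ {x y} → Orbit gs x y → Orbit gs y x
  orbit-sym invol here = here
  orbit-sym invol {x} (step t q) =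
    orbit-trans (orbit-sym invol q) (step t (subst (λ y → Orbit gs y x) (sym (invol t x)) here))

  orbit-mono : ∀ {hs} → (∀ {t} → t ∈ gs → t ∈ hs) → ∀ {x y} → Orbit gs x y → Orbit hs x y
  orbit-mono sub here       = here
  orbit-mono sub (step t q) = step (sub t) (orbit-mono sub q)

module Numbering {A : Set} {f} (A↔ : Fin f ↔ A) where
  open Inverse A↔ public using () renaming
    (to to decode; from to encode; strictlyInverseˡ to decode-encode; strictlyInverseʳ to encode-decode)

  conjugate : (A → A) → Fin f → Fin f
  conjugate t = encode ∘ t ∘ decode

  conjugate-encode : ∀ t x → conjugate t (encode x) ≡ encode (t x)
  conjugate-encode t x = cong (encode ∘ t) (decode-encode x)

  decode-conjugate : ∀ t x → decode (conjugate t x) ≡ t (decode x)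
  decode-conjugate t x = decode-encode (t (decode x))

  encode-reach : ∀ {gs x y} → Orbit gs x y → Reach (map conjugate gs) (encode x) (encode y)
  encode-reach here = here
  encode-reach {gs} {x} {y} (step {t = t} p q) = step (∈-map⁺ conjugate p)
    (subst (λ z → Reach (map conjugate gs) z (encode y)) (sym (conjugate-encode t x)) (encode-reach q))

  decode-reach : ∀ {gs x y} → Orbit gs (decode x) (decode y) → Reach (map conjugate gs) x y
  decode-reach q = subst₂ (Reach _) (encode-decode _) (encode-decode _) (encode-reach q)

  -- It suffices that `q` is invariant and that each point reaches a representative depending only
  -- on its value under `q`; two points with equal values are then joined through their common
  -- representative.
  orbitMap : ∀ {C : Set} {c} (C↔ : Fin c ↔ C) {gs : List (A → A)} →
    (∀ {t} → t ∈ gs → ∀ x → t (t x) ≡ x) →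
    (q : A → C) → (∀ {t} → t ∈ gs → ∀ x → q (t x) ≡ q x) →
    (rep : C → A) → (∀ X → q (rep X) ≡ X) → (∀ x → Orbit gs x (rep (q x))) →
    OrbitMap (map conjugate gs) c (Inverse.from C↔ ∘ q ∘ decode)
  orbitMap {c = c} C↔ {gs} invol q q-inv rep q-rep reach = onto , λ x y → mk⇔ (joined x y) (invariant x y)
    where
    module C = Inverse C↔
    q′ : Fin f → Fin c
    q′ = C.from ∘ q ∘ decode
    onto : Surjective _≡_ _≡_ q′
    onto X = encode (rep (C.to X)) , λ { refl →
      trans (cong (C.from ∘ q) (decode-encode _)) (trans (cong C.from (q-rep _)) (C.strictlyInverseʳ X)) }
    joined : ∀ x y → q′ x ≡ q′ y → Reach (map conjugate gs) x y
    joined x y e = decode-reach (orbit-trans (reach (decode x))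
      (subst (λ X → Orbit gs (rep X) (decode y)) (sym same) (orbit-sym invol (reach (decode y)))))
      where
      same : q (decode x) ≡ q (decode y)
      same = trans (sym (C.strictlyInverseˡ _)) (trans (cong C.to e) (C.strictlyInverseˡ _))
    invariant : ∀ x y → Reach (map conjugate gs) x y → q′ x ≡ q′ y
    invariant x y r = reach-invariant (λ z → q′ x ≡ q′ z) keep r refl
      where
      keep : ∀ {t z} → t ∈ map conjugate gs → q′ x ≡ q′ z → q′ x ≡ q′ (t z)
      keep {z = z} t∈ e with ∈-map⁻ conjugate t∈
      ... | t , p , refl = trans e (cong C.from
              (trans (sym (q-inv p (decode z))) (cong q (sym (decode-conjugate t z)))))

  conjugate-fpf : ∀ t → (∀ x → t (t x) ≡ x) → (∀ x → t x ≢ x) → FPFInvolution (conjugate t)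
  conjugate-fpf t invol fpf =
    (λ x → trans (conjugate-encode t _) (trans (cong encode (invol _)) (encode-decode x))) ,
    (λ x e → fpf (decode x) (trans (sym (decode-conjugate t x)) (cong decode e)))

  decode-conjugate₂ : ∀ t u x → decode (conjugate t (conjugate u x)) ≡ t (u (decode x))
  decode-conjugate₂ t u x = trans (decode-conjugate t (conjugate u x)) (cong t (decode-conjugate u x))

  decode-injective : ∀ {x y} → decode x ≡ decode y → x ≡ y
  decode-injective {x} {y} e = trans (sym (encode-decode x)) (trans (cong encode e) (encode-decode y))

  conjugate-comm : ∀ t u → (∀ x → t (u x) ≡ u (t x)) →
    ∀ x → conjugate t (conjugate u x) ≡ conjugate u (conjugate t x)
  conjugate-comm t u comm x = decode-injective
    (trans (decode-conjugate₂ t u x) (trans (comm (decode x)) (sym (decode-conjugate₂ u t x))))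

  conjugate₂-fpf : ∀ t u → (∀ x → t (u x) ≢ x) → ∀ x → conjugate t (conjugate u x) ≢ x
  conjugate₂-fpf t u fpf x e = fpf (decode x) (trans (sym (decode-conjugate₂ t u x)) (cong decode e))

-- A square grid of (suc n)² vertices in which the right side is glued to the bottom side and the
-- top side to the left side: the boundary word a a b b⁻¹ gives the projective plane.
-- A flag consists of a vertex (row , column), a corner (horizontal side , vertical side) at
-- it, and the axis of one of the two half-edges bounding that corner.
module Grid (n : ℕ) where

  Vertex : Set
  Vertex = Fin (suc n) × Fin (suc n)

  pattern east = true
  pattern west = false
  pattern north = true
  pattern south = false
  pattern horizontal = true
  pattern vertical = false

  Flag : Set
  Flag = Vertex × (Bool × Bool × Bool)

  last : Fin (suc n)
  last = fromℕ n

  τ₀ τ₁ τ₂ : Flag → Flag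
  τ₁ (p , h , v , a) = p , h , v , not a
  τ₂ (p , h , v , horizontal) = p , h , not v , horizontal
  τ₂ (p , h , v , vertical)   = p , not h , v , vertical

  -- Leaving the right side in row i means entering the bottom side in column i, with north becoming
  -- east. This is the wrap-around that a token on the cycle performs. Left and top sides are glued
  -- against the order, whence `opposite` and `not`; this gluing closes the surface without changing
  -- its type.
  crossHorizontally : Bool → Bool → Fin (suc n) → Fin (suc n) → Flag
  crossHorizontally east v i j with view j
  ... | ‵fromℕ     = (zero , i) , v , south , vertical
  ... | ‵inject₁ k = (i , suc k) , west , v , horizontal
  crossHorizontally west v i (suc j) = (i , inject₁ j) , east , v , horizontal
  crossHorizontally west v i zero    = (last , opposite i) , not v , north , vertical

  crossVertically : Bool → Bool → Fin (suc n) → Fin (suc n) → Flag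
  crossVertically h north i j with view i
  ... | ‵fromℕ     = (opposite j , zero) , west , not h , horizontal
  ... | ‵inject₁ k = (suc k , j) , h , south , vertical
  crossVertically h south (suc i) j = (inject₁ i , j) , h , north , vertical
  crossVertically h south zero    j = (j , last) , east , h , horizontal

  τ₀ ((i , j) , h , v , horizontal) = crossHorizontally h v i j
  τ₀ ((i , j) , h , v , vertical)   = crossVertically h v i j

  τ₀-east : ∀ i j v → τ₀ ((i , inject₁ j) , east , v , horizontal) ≡ ((i , suc j) , west , v , horizontal)
  τ₀-east i j v rewrite view-inject₁ j = refl

  τ₀-east-last : ∀ i v → τ₀ ((i , last) , east , v , horizontal) ≡ ((zero , i) , v , south , vertical)
  τ₀-east-last i v rewrite view-fromℕ n = refl

  τ₀-north : ∀ i j h → τ₀ ((inject₁ i , j) , h , north , vertical) ≡ ((suc i , j) , h , south , vertical)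
  τ₀-north i j h rewrite view-inject₁ i = refl

  τ₀-north-last : ∀ j h → τ₀ ((last , j) , h , north , vertical) ≡ ((opposite j , zero) , west , not h , horizontal)
  τ₀-north-last j h rewrite view-fromℕ n = refl

  τ₀-invol : ∀ x → τ₀ (τ₀ x) ≡ x
  τ₀-invol ((i , j) , east , v , horizontal) with view j
  ... | ‵fromℕ     = refl
  ... | ‵inject₁ k = refl
  τ₀-invol ((i , suc j) , west , v , horizontal) = τ₀-east i j v
  τ₀-invol ((i , zero) , west , v , horizontal) = trans (τ₀-north-last (opposite i) (not v))
    (cong₂ (λ i v → (i , zero) , west , v , horizontal) (Finₚ.opposite-involutive i) (Boolₚ.not-involutive v))
  τ₀-invol ((i , j) , h , north , vertical) with view i
  ... | ‵fromℕ = cong₂ (λ j h → (last , j) , h , north , vertical)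
                   (Finₚ.opposite-involutive j) (Boolₚ.not-involutive h)
  ... | ‵inject₁ k = refl
  τ₀-invol ((suc i , j) , h , south , vertical) = τ₀-north i j h
  τ₀-invol ((zero , j) , h , south , vertical) = τ₀-east-last j h

  τ₁-invol : ∀ x → τ₁ (τ₁ x) ≡ x
  τ₁-invol (p , h , v , a) = cong (λ a → p , h , v , a) (Boolₚ.not-involutive a)

  τ₂-invol : ∀ x → τ₂ (τ₂ x) ≡ x
  τ₂-invol (p , h , v , horizontal) = cong (λ v → p , h , v , horizontal) (Boolₚ.not-involutive v)
  τ₂-invol (p , h , v , vertical)   = cong (λ h → p , h , v , vertical) (Boolₚ.not-involutive h)

  τ₀τ₂-comm : ∀ x → τ₀ (τ₂ x) ≡ τ₂ (τ₀ x)
  τ₀τ₂-comm ((i , j) , east , v , horizontal) with view j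
  ... | ‵fromℕ     = refl
  ... | ‵inject₁ k = refl
  τ₀τ₂-comm ((i , suc j) , west , v , horizontal) = refl
  τ₀τ₂-comm ((i , zero) , west , v , horizontal) = refl
  τ₀τ₂-comm ((i , j) , h , north , vertical) with view i
  ... | ‵fromℕ     = refl
  ... | ‵inject₁ k = refl
  τ₀τ₂-comm ((suc i , j) , h , south , vertical) = refl
  τ₀τ₂-comm ((zero , j) , h , south , vertical) = refl

  position : Flag → Vertex
  position = proj₁

  axis : Flag → Bool
  axis (_ , _ , _ , a) = a

  -- Every edge has one end at which it leaves to the east or to the north.
  outgoing : Flag → Bool
  outgoing (p , h , v , horizontal) = h
  outgoing (p , h , v , vertical)   = v

  outgoing-τ₀ : ∀ x → outgoing (τ₀ x) ≡ not (outgoing x)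
  outgoing-τ₀ ((i , j) , east , v , horizontal) with view j
  ... | ‵fromℕ     = refl
  ... | ‵inject₁ k = refl
  outgoing-τ₀ ((i , suc j) , west , v , horizontal) = refl
  outgoing-τ₀ ((i , zero) , west , v , horizontal) = refl
  outgoing-τ₀ ((i , j) , h , north , vertical) with view i
  ... | ‵fromℕ     = refl
  ... | ‵inject₁ k = refl
  outgoing-τ₀ ((suc i , j) , h , south , vertical) = refl
  outgoing-τ₀ ((zero , j) , h , south , vertical) = refl

  outgoing-τ₂ : ∀ x → outgoing (τ₂ x) ≡ outgoing x
  outgoing-τ₂ (p , h , v , horizontal) = refl
  outgoing-τ₂ (p , h , v , vertical)   = refl

  τ₀-fpf : ∀ x → τ₀ x ≢ x
  τ₀-fpf x e = Boolₚ.not-¬ {outgoing x} refl (trans (sym (cong outgoing e)) (outgoing-τ₀ x))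

  τ₁-fpf : ∀ x → τ₁ x ≢ x
  τ₁-fpf x e = Boolₚ.not-¬ {axis x} refl (sym (cong axis e))

  τ₂-fpf : ∀ x → τ₂ x ≢ x
  τ₂-fpf (p , h , true , horizontal) ()
  τ₂-fpf (p , h , false , horizontal) ()
  τ₂-fpf (p , true , v , vertical) ()
  τ₂-fpf (p , false , v , vertical) ()

  τ₀τ₂-fpf : ∀ x → τ₀ (τ₂ x) ≢ x
  τ₀τ₂-fpf x e = Boolₚ.not-¬ {outgoing x} refl
    (trans (sym (cong outgoing e)) (trans (outgoing-τ₀ (τ₂ x)) (cong not (outgoing-τ₂ x))))

  involutive : ∀ {t} → t ∈ τ₀ ∷ τ₁ ∷ τ₂ ∷ [] → ∀ x → t (t x) ≡ x
  involutive (here refl)                 = τ₀-invol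
  involutive (there (here refl))         = τ₁-invol
  involutive (there (there (here refl))) = τ₂-invol

  cornerFlag : Vertex → Flag
  cornerFlag p = p , east , north , horizontal

  vertexOrbit : ∀ x → Orbit (τ₁ ∷ τ₂ ∷ []) x (cornerFlag (position x))
  vertexOrbit (p , h , v , a) = reach h v a
    where
    by₁ : ∀ {x y} → Orbit (τ₁ ∷ τ₂ ∷ []) (τ₁ x) y → Orbit (τ₁ ∷ τ₂ ∷ []) x y
    by₁ = step (here refl)
    by₂ : ∀ {x y} → Orbit (τ₁ ∷ τ₂ ∷ []) (τ₂ x) y → Orbit (τ₁ ∷ τ₂ ∷ []) x y
    by₂ = step (there (here refl))
    reach : ∀ h v a → Orbit (τ₁ ∷ τ₂ ∷ []) (p , h , v , a) (cornerFlag p)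
    reach true  true  true  = here
    reach true  true  false = by₁ here
    reach true  false true  = by₂ here
    reach true  false false = by₁ (by₂ here)
    reach false true  true  = by₁ (by₂ (by₁ here))
    reach false true  false = by₂ (by₁ here)
    reach false false true  = by₂ (by₁ (by₂ (by₁ here)))
    reach false false false = by₂ (by₁ (by₂ here))

  private
    all : List (Flag → Flag)
    all = τ₀ ∷ τ₁ ∷ τ₂ ∷ []

    local : ∀ {p h v a h′ v′ a′} → Orbit all (p , h , v , a) (p , h′ , v′ , a′)
    local = orbit-trans (orbit-mono there (vertexOrbit _))
      (orbit-sym involutive (orbit-mono there (vertexOrbit _)))

    westward : ∀ i j → Orbit all (cornerFlag (i , suc j)) (cornerFlag (i , inject₁ j))
    westward i j = orbit-trans (local {h′ = west} {v′ = north} {a′ = horizontal}) (step (here refl) here)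

    southward : ∀ i j → Orbit all (cornerFlag (suc i , j)) (cornerFlag (inject₁ i , j))
    southward i j = orbit-trans (local {h′ = east} {v′ = south} {a′ = vertical}) (step (here refl) local)

  connected : ∀ x y → Orbit all x y
  connected x y = orbit-trans (home x) (orbit-sym involutive (home y))
    where
    home : ∀ x → Orbit all x (cornerFlag (zero , zero))
    home ((i , j) , _) = orbit-trans local (orbit-trans
      (<-weakInduction (λ j → Orbit all (cornerFlag (i , j)) (cornerFlag (i , zero))) here
        (λ k r → orbit-trans (westward i k) r) j)
      (<-weakInduction (λ i → Orbit all (cornerFlag (i , zero)) (cornerFlag (zero , zero))) here
        (λ k r → orbit-trans (southward k zero) r) i))

  -- An edge across the sides of the square is horizontal at one end and vertical at the other; the
  -- vertex and the axis recorded are those of its outgoing end.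
  Edge : Set
  Edge = Vertex × Bool

  edge-case : Bool → Flag → Edge
  edge-case true  x = position x , axis x
  edge-case false x = position (τ₀ x) , axis (τ₀ x)

  edge : Flag → Edge
  edge x = edge-case (outgoing x) x

  edgeFlag : Edge → Flag
  edgeFlag (p , a) = p , east , north , a

  edge-edgeFlag : ∀ e → edge (edgeFlag e) ≡ e
  edge-edgeFlag (p , horizontal) = refl
  edge-edgeFlag (p , vertical)   = refl

  edge-τ₀ : ∀ x → edge (τ₀ x) ≡ edge x
  edge-τ₀ x rewrite outgoing-τ₀ x with outgoing x
  ... | true  = cong (λ y → position y , axis y) (τ₀-invol x)
  ... | false = refl

  same-edge-end : ∀ x → (position (τ₂ x) , axis (τ₂ x)) ≡ (position x , axis x)
  same-edge-end (p , h , v , horizontal) = refl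
  same-edge-end (p , h , v , vertical)   = refl

  edge-τ₂ : ∀ x → edge (τ₂ x) ≡ edge x
  edge-τ₂ x rewrite outgoing-τ₂ x with outgoing x
  ... | true  = same-edge-end x
  ... | false rewrite τ₀τ₂-comm x = same-edge-end (τ₀ x)

  edgeOrbit : ∀ x → Orbit (τ₀ ∷ τ₂ ∷ []) x (edgeFlag (edge x))
  edgeOrbit x = by-direction (outgoing x) refl
    where
    out : ∀ y → outgoing y ≡ true → Orbit (τ₀ ∷ τ₂ ∷ []) y (edgeFlag (position y , axis y))
    out (p , true , true , horizontal)  refl = here
    out (p , true , false , horizontal) refl = step (there (here refl)) here
    out (p , true , true , vertical)    refl = here
    out (p , false , true , vertical)   refl = step (there (here refl)) here
    by-direction : ∀ b → outgoing x ≡ b → Orbit (τ₀ ∷ τ₂ ∷ []) x (edgeFlag (edge-case b x))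
    by-direction true  e = out x e
    by-direction false e = step (here refl) (out (τ₀ x) (trans (outgoing-τ₀ x) (cong not e)))

  -- A face is named by the vertex at which it forms the north-east corner; the loop at the
  -- vertex (last , zero) bounds the only face without such a corner.
  Face : Set
  Face = Maybe Vertex

  westFace : Fin (suc n) → Fin (suc n) → Face
  westFace i (suc j) = just (i , inject₁ j)
  westFace i zero    = nothing

  southEast : Fin (suc n) → Fin (suc n) → Vertex
  southEast (suc i) j = inject₁ i , j
  southEast zero    j = j , last

  northWest southWest : Fin (suc n) → Fin (suc n) → Face
  northWest i (suc j) = just (i , inject₁ j)
  northWest i zero    = westFace last (opposite i)

  southWest zero    j       = just (southEast j last)
  southWest (suc i) (suc j) = just (inject₁ i , inject₁ j)
  southWest (suc i) zero    = just (last , opposite (suc i))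

  cornerFace : Bool → Bool → Fin (suc n) → Fin (suc n) → Face
  cornerFace east north i j = just (i , j)
  cornerFace east south i j = just (southEast i j)
  cornerFace west north i j = northWest i j
  cornerFace west south i j = southWest i j

  face : Flag → Face
  face ((i , j) , h , v , _) = cornerFace h v i j

  faceFlag : Face → Flag
  faceFlag (just p) = p , east , north , horizontal
  faceFlag nothing  = (last , zero) , west , north , horizontal

  opposite-last : ∀ n → opposite (fromℕ n) ≡ zero
  opposite-last n = Finₚ.opposite-involutive zero

  opposite-inject₁ : ∀ {m} (i : Fin m) → opposite (inject₁ i) ≡ suc (opposite i)
  opposite-inject₁ zero    = refl
  opposite-inject₁ (suc i) = cong inject₁ (opposite-inject₁ i)

  face-faceFlag : ∀ X → face (faceFlag X) ≡ X
  face-faceFlag (just p) = refl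
  face-faceFlag nothing rewrite opposite-last n = refl

  face-τ₁ : ∀ x → face (τ₁ x) ≡ face x
  face-τ₁ x = refl

  private
    top-right : ∀ j → southWest (opposite j) zero ≡ just (last , j)
    top-right j with opposite j in e
    ... | zero  = cong (λ k → just (last , k)) (trans (cong opposite (sym e)) (Finₚ.opposite-involutive j))
    ... | suc k = cong (λ k → just (last , k)) (trans (cong opposite (sym e)) (Finₚ.opposite-involutive j))

    top-left : ∀ j → northWest (opposite j) zero ≡ northWest last j
    top-left j rewrite Finₚ.opposite-involutive j with j
    ... | suc k = refl
    ... | zero rewrite opposite-last n = refl

    left : ∀ i j → southWest (suc i) j ≡ northWest (inject₁ i) j
    left i (suc j) = refl
    left i zero rewrite opposite-inject₁ i = refl

    bottom : ∀ i j → southWest i (suc j) ≡ just (southEast i (inject₁ j))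
    bottom zero    j = refl
    bottom (suc i) j = refl

  face-τ₀-outgoing : ∀ x → outgoing x ≡ true → face (τ₀ x) ≡ face x
  face-τ₀-outgoing ((i , j) , east , v , horizontal) _ with view j | v
  ... | ‵fromℕ     | north = refl
  ... | ‵fromℕ     | south = refl
  ... | ‵inject₁ k | north = refl
  ... | ‵inject₁ k | south = bottom i k
  face-τ₀-outgoing ((i , j) , h , north , vertical) _ with view i | h
  ... | ‵fromℕ     | east = top-right j
  ... | ‵fromℕ     | west = top-left j
  ... | ‵inject₁ k | east = refl
  ... | ‵inject₁ k | west = left k j

  face-τ₀ : ∀ x → face (τ₀ x) ≡ face x
  face-τ₀ x = by-direction (outgoing x) refl
    where
    by-direction : ∀ b → outgoing x ≡ b → face (τ₀ x) ≡ face x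
    by-direction true  e = face-τ₀-outgoing x e
    by-direction false e = trans (sym (face-τ₀-outgoing (τ₀ x) (trans (outgoing-τ₀ x) (cong not e))))
                                 (cong face (τ₀-invol x))

  faceOrbit : ∀ x → Orbit (τ₀ ∷ τ₁ ∷ []) x (faceFlag (face x))
  faceOrbit ((i , j) , h , v , a) = orbit-trans (turn a) (reach i j h v)
    where
    O = Orbit (τ₀ ∷ τ₁ ∷ [])
    turn : ∀ {p h v} a → O (p , h , v , a) (p , h , v , horizontal)
    turn horizontal = here
    turn vertical   = step (there (here refl)) here
    cross-h : ∀ {p h v y} → O (τ₀ (p , h , v , horizontal)) y → O (p , h , v , horizontal) y
    cross-h = step (here refl)
    cross-v : ∀ {p h v y} → O (τ₀ (p , h , v , vertical)) y → O (p , h , v , horizontal) y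
    cross-v r = step (there (here refl)) (step (here refl) r)
    se : ∀ i j → O ((i , j) , east , south , horizontal) (faceFlag (just (southEast i j)))
    se (suc i) j = cross-v (turn vertical)
    se zero    j = cross-v here
    wf : ∀ i → O ((last , i) , west , north , horizontal) (faceFlag (westFace last i))
    wf (suc i) = cross-h here
    wf zero    = here
    reach : ∀ i j h v → O ((i , j) , h , v , horizontal) (faceFlag (cornerFace h v i j))
    reach i j east north = here
    reach i j east south = se i j
    reach i (suc j) west north = cross-h here
    reach i zero west north = cross-h (orbit-trans (turn vertical) (wf (opposite i)))
    reach zero j west south = cross-v (se j last)
    reach (suc i) (suc j) west south = cross-h (se (suc i) (inject₁ j))
    reach (suc i) zero west south = cross-h (turn vertical)

  vertices↔ : Fin (suc n * suc n) ↔ Vertex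
  vertices↔ = Finₚ.*↔×

  edges↔ : Fin (suc n * suc n * 2) ↔ Edge
  edges↔ = (vertices↔ ×-↔ Finₚ.2↔Bool) ↔-∘ Finₚ.*↔×

  faces↔ : Fin (suc (suc n * suc n)) ↔ Face
  faces↔ = mk↔ₛ′ to from to∘from from∘to
    where
    module V = Inverse vertices↔
    to : Fin (suc (suc n * suc n)) → Face
    to zero    = nothing
    to (suc x) = just (V.to x)
    from : Face → Fin (suc (suc n * suc n))
    from nothing  = zero
    from (just p) = suc (V.from p)
    to∘from : ∀ X → to (from X) ≡ X
    to∘from nothing  = refl
    to∘from (just p) = cong just (V.strictlyInverseˡ p)
    from∘to : ∀ x → from (to x) ≡ x
    from∘to zero    = refl
    from∘to (suc x) = cong suc (V.strictlyInverseʳ x)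

  flags↔ : Fin (suc n * suc n * (2 * (2 * 2))) ↔ Flag
  flags↔ = (vertices↔ ×-↔ ((Finₚ.2↔Bool ×-↔ ((Finₚ.2↔Bool ×-↔ Finₚ.2↔Bool) ↔-∘ Finₚ.*↔×)) ↔-∘ Finₚ.*↔×)) ↔-∘ Finₚ.*↔×

  open Numbering flags↔

  gridMap : ProjectivePlaneMap
  gridMap = record
    { flags = suc n * suc n * 8
    ; τ₀ = conjugate τ₀ ; τ₁ = conjugate τ₁ ; τ₂ = conjugate τ₂
    ; τ₀-inv = conjugate-fpf τ₀ τ₀-invol τ₀-fpf
    ; τ₁-inv = conjugate-fpf τ₁ τ₁-invol τ₁-fpf
    ; τ₂-inv = conjugate-fpf τ₂ τ₂-invol τ₂-fpf
    ; τ₀τ₂-comm = conjugate-comm τ₀ τ₂ τ₀τ₂-comm ; τ₀τ₂-fpf = conjugate₂-fpf τ₀ τ₂ τ₀τ₂-fpf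
    ; connected = λ x y → decode-reach (connected (decode x) (decode y))
    ; #V = suc n * suc n ; #E = suc n * suc n * 2 ; #F = suc (suc n * suc n)
    ; vert = Inverse.from vertices↔ ∘ position ∘ decode
    ; edge = Inverse.from edges↔ ∘ edge ∘ decode
    ; face = Inverse.from faces↔ ∘ face ∘ decode
    ; vert-orbits = orbitMap vertices↔ (involutive ∘ there) position
        (λ { (here refl) x → refl
           ; (there (here refl)) (_ , _ , _ , horizontal) → refl
           ; (there (here refl)) (_ , _ , _ , vertical) → refl })
        cornerFlag (λ _ → refl) vertexOrbit
    ; edge-orbits = orbitMap edges↔
        (λ { (here refl) → τ₀-invol ; (there (here refl)) → τ₂-invol }) edge
        (λ { (here refl) → edge-τ₀ ; (there (here refl)) → edge-τ₂ })
        edgeFlag edge-edgeFlag edgeOrbit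
    ; face-orbits = orbitMap faces↔
        (λ { (here refl) → τ₀-invol ; (there (here refl)) → τ₁-invol }) face
        (λ { (here refl) → face-τ₀ ; (there (here refl)) → face-τ₁ })
        faceFlag face-faceFlag faceOrbit
    ; euler = count (suc n * suc n)
    }
    where
    count : ∀ v → v + suc v ≡ v * 2 + 1
    count = solve-∀

  vertexNumber : Vertex → Fin (suc n * suc n)
  vertexNumber = Inverse.from vertices↔

  vertexNumber-injective : Injective _≡_ _≡_ vertexNumber
  vertexNumber-injective {p} {q} e = trans (sym (Inverse.strictlyInverseˡ vertices↔ p))
    (trans (cong (Inverse.to vertices↔) e) (Inverse.strictlyInverseˡ vertices↔ q))

  adjacent : ∀ x → MapAdj gridMap (vertexNumber (position x)) (vertexNumber (position (τ₀ x)))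
  adjacent x = encode x , cong (vertexNumber ∘ position) (decode-encode x) ,
    cong (vertexNumber ∘ position) (trans (decode-conjugate τ₀ (encode x)) (cong τ₀ (decode-encode x)))

  data GridAdj : Vertex → Vertex → Set where
    eastward  : ∀ i j → GridAdj (i , inject₁ j) (i , suc j)
    northward : ∀ i j → GridAdj (inject₁ i , j) (suc i , j)
    around    : ∀ i → GridAdj (i , last) (zero , i)
    converse  : ∀ {p q} → GridAdj p q → GridAdj q p

  gridAdj⇒MapAdj : ∀ {p q} → GridAdj p q → MapAdj gridMap (vertexNumber p) (vertexNumber q)
  gridAdj⇒MapAdj (eastward i j) =
    subst (λ x → MapAdj gridMap (vertexNumber (i , inject₁ j)) (vertexNumber (position x)))
      (τ₀-east i j north) (adjacent ((i , inject₁ j) , east , north , horizontal))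
  gridAdj⇒MapAdj (northward i j) =
    subst (λ x → MapAdj gridMap (vertexNumber (inject₁ i , j)) (vertexNumber (position x)))
      (τ₀-north i j east) (adjacent ((inject₁ i , j) , east , north , vertical))
  gridAdj⇒MapAdj (around i) =
    subst (λ x → MapAdj gridMap (vertexNumber (i , last)) (vertexNumber (position x)))
      (τ₀-east-last i north) (adjacent ((i , last) , east , north , horizontal))
  gridAdj⇒MapAdj (converse a) = let x , p , q = gridAdj⇒MapAdj a in
    conjugate τ₀ x , q ,
    trans (cong (vertexNumber ∘ position ∘ decode) (proj₁ (conjugate-fpf τ₀ τ₀-invol τ₀-fpf) x)) p

-- Token graphs of cycles

-- The elements of a sorted pair, named in either order, so that the moving and the resting token
-- can be told apart without comparing them.
data Is {n} : Pair n → Fin n → Fin n → Set where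
  ascending  : ∀ {a b a<b} → Is ((a , b) , a<b) a b
  descending : ∀ {a b a<b} → Is ((a , b) , a<b) b a

module _ {n : ℕ} where

  is-swap : ∀ {X : Pair n} {a b} → Is X a b → Is X b a
  is-swap ascending  = descending
  is-swap descending = ascending

  is-distinct : ∀ {X : Pair n} {a b} → Is X a b → a ≢ b
  is-distinct {_ , a<b} ascending  e = Finₚ.<⇒≢ a<b e
  is-distinct {_ , a<b} descending e = Finₚ.<⇒≢ a<b (sym e)

  is-match : ∀ {X : Pair n} {a b c d} → Is X a b → Is X c d → (a ≡ c × b ≡ d) ⊎ (a ≡ d × b ≡ c)
  is-match ascending  ascending  = inj₁ (refl , refl)
  is-match ascending  descending = inj₂ (refl , refl)
  is-match descending ascending  = inj₂ (refl , refl)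
  is-match descending descending = inj₁ (refl , refl)

  is-unique : ∀ {X Y : Pair n} {a b} → Is X a b → Is Y a b → X ≡ Y
  is-unique {_ , x} {_ , y} ascending  ascending  = cong (_ ,_) (Finₚ.<-irrelevant x y)
  is-unique {_ , x} {_ , y} ascending  descending = contradiction y (Finₚ.<-asym x)
  is-unique {_ , x} {_ , y} descending ascending  = contradiction y (Finₚ.<-asym x)
  is-unique {_ , x} {_ , y} descending descending = cong (_ ,_) (Finₚ.<-irrelevant x y)

  pair : ∀ {a b : Fin n} → a ≢ b → ∃ λ X → Is X a b
  pair {a} {b} a≢b with Finₚ.<-cmp a b
  ... | tri< a<b _ _ = ((a , b) , a<b) , ascending
  ... | tri≈ _ a≡b _ = contradiction a≡b a≢b
  ... | tri> _ _ b<a = ((b , a) , b<a) , descending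

  is-∈ : ∀ {X : Pair n} {a b} → Is X a b → a ∈₂ X
  is-∈ ascending  = inj₁ refl
  is-∈ descending = inj₂ refl

  ∈-is : ∀ {X : Pair n} {a b z} → Is X a b → z ∈₂ X → z ≡ a ⊎ z ≡ b
  ∈-is ascending  h = h
  ∈-is descending h = swap h

  ∈-other : ∀ (X : Pair n) {a} → a ∈₂ X → ∃ λ b → Is X a b
  ∈-other X (inj₁ refl) = _ , ascending
  ∈-other X (inj₂ refl) = _ , descending

allPairs : ∀ n → List (Pair n)
allPairs zero    = []
allPairs (suc n) = map (λ i → (zero , suc i) , s≤s z≤n) (allFin n)
                ++ map (λ { ((a , b) , a<b) → (suc a , suc b) , s≤s a<b }) (allPairs n)

∈-allPairs : ∀ {n} (X : Pair n) → X ∈ allPairs n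
∈-allPairs {suc n} ((zero , suc b) , s≤s z≤n) = ∈-++⁺ˡ (∈-map⁺ _ (∈-allFin b))
∈-allPairs {suc n} ((suc a , suc b) , s≤s a<b) = ∈-++⁺ʳ _ (∈-map⁺ _ (∈-allPairs ((a , b) , a<b)))

length-allPairs : ∀ n → length (allPairs (suc n)) * 2 ≡ suc n * n
length-allPairs zero = refl
length-allPairs (suc n) = begin
  length (allPairs (suc (suc n))) * 2         ≡⟨ cong (_* 2) (length-++ (map _ (allFin (suc n)))) ⟩
  (length (map (λ i → (zero , suc i) , s≤s z≤n) (allFin (suc n))) + length (map _ (allPairs (suc n)))) * 2
    ≡⟨ cong₂ (λ a b → (a + b) * 2) (trans (length-map _ (allFin (suc n))) (length-tabulate (id {A = Fin (suc n)})))
                                   (length-map _ (allPairs (suc n))) ⟩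
  (suc n + length (allPairs (suc n))) * 2     ≡⟨ ℕₚ.*-distribʳ-+ 2 (suc n) (length (allPairs (suc n))) ⟩
  suc n * 2 + length (allPairs (suc n)) * 2   ≡⟨ cong (suc n * 2 +_) (length-allPairs n) ⟩
  suc n * 2 + suc n * n                       ≡⟨ sym (ℕₚ.*-distribˡ-+ (suc n) 2 n) ⟩
  suc n * suc (suc n)                         ≡⟨ ℕₚ.*-comm (suc n) (suc (suc n)) ⟩
  suc (suc n) * suc n                         ∎
  where open ≡-Reasoning

record Move {n} (G : Graph n) (X Y : Pair n) : Set where
  constructor move
  field
    {from to still} : Fin n
    along           : Graph.E G from to
    source          : Is X from still
    target          : Is Y to still

module _ {n} {G : Graph n} where
  open Graph G using (E; irrefl)

  move⇒F₂ : ∀ {X Y} → Move G X Y → F₂ G X Y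
  move⇒F₂ {X} {Y} (move {x} {y} {w} e s t) =
    x , y , e , is-∈ s , x∉Y , is-∈ t , y∉X , onlyX , onlyY
    where
    x∉Y : ¬ x ∈₂ Y
    x∉Y h = [ (λ { refl → irrefl e }) , is-distinct s ] (∈-is t h)
    y∉X : ¬ y ∈₂ X
    y∉X h = [ (λ { refl → irrefl e }) , is-distinct t ] (∈-is s h)
    onlyX : ∀ z → z ∈₂ X → ¬ z ∈₂ Y → z ≡ x
    onlyX z h k = [ id , (λ { refl → contradiction (is-∈ (is-swap t)) k }) ] (∈-is s h)
    onlyY : ∀ z → z ∈₂ Y → ¬ z ∈₂ X → z ≡ y
    onlyY z h k = [ id , (λ { refl → contradiction (is-∈ (is-swap s)) k }) ] (∈-is t h)

  -- The partner of `x` in `X` must lie in `Y`, since `x` is the only element of `X` outside `Y`; it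
  -- is then the partner of `y` as well.
  F₂⇒move : ∀ X Y → F₂ G X Y → Move G X Y
  F₂⇒move X Y (x , y , e , x∈X , x∉Y , y∈Y , y∉X , onlyX , onlyY) with ∈-other X x∈X | ∈-other Y y∈Y
  ... | w , s | w′ , t with w Finₚ.≟ w′
  ... | yes refl = move e s t
  ... | no w≢w′  = contradiction (sym (onlyX w (is-∈ (is-swap s)) w∉Y)) (is-distinct s)
    where
    w∉Y : ¬ w ∈₂ Y
    w∉Y h = [ (λ { refl → y∉X (is-∈ (is-swap s)) }) , w≢w′ ] (∈-is t h)

  move-sym : ∀ {X Y} → Move G X Y → Move G Y X
  move-sym (move e s t) = move (Graph.sym G e) t s

  F₂-sym : ∀ X Y → F₂ G X Y → F₂ G Y X
  F₂-sym X Y = move⇒F₂ ∘ move-sym ∘ F₂⇒move X Y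

  F₂-irrefl : ∀ X → ¬ F₂ G X X
  F₂-irrefl X (_ , _ , _ , x∈X , x∉X , _) = x∉X x∈X

  -- Three moves close up in two ways: one token runs round a triangle of `G`, or the two tokens
  -- alternate, and then the three edges used again form a triangle. Every other pattern forces a
  -- loop or a pair with equal elements.
  F₂-triangle-free : (∀ {x y z} → E x y → E y z → E z x → ⊥) →
    ∀ X Y Z → F₂ G X Y → F₂ G Y Z → F₂ G Z X → ⊥
  F₂-triangle-free tri X Y Z f g h = go (F₂⇒move X Y f) (F₂⇒move Y Z g) (F₂⇒move Z X h)
    where
    go : ∀ {X Y Z} → Move G X Y → Move G Y Z → Move G Z X → ⊥
    go (move e₁ s₁ t₁) (move e₂ s₂ t₂) (move e₃ s₃ t₃) with is-match t₁ s₂ | is-match t₂ s₃ | is-match t₃ s₁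
    ... | inj₁ (refl , refl) | inj₁ (refl , refl) | inj₁ (refl , _)    = tri e₁ e₂ e₃
    ... | inj₁ (refl , refl) | inj₁ (refl , refl) | inj₂ (_ , w≡x)     = is-distinct s₁ (sym w≡x)
    ... | inj₁ (refl , refl) | inj₂ (refl , refl) | inj₁ (_ , z≡w)     = is-distinct t₂ z≡w
    ... | inj₁ (refl , refl) | inj₂ (refl , refl) | inj₂ (refl , _)    = irrefl e₃
    ... | inj₂ (refl , refl) | inj₁ (refl , refl) | inj₁ (_ , y≡w)     = is-distinct t₁ y≡w
    ... | inj₂ (refl , refl) | inj₁ (refl , refl) | inj₂ (_ , refl)    = irrefl e₁
    ... | inj₂ (refl , refl) | inj₂ (refl , refl) | inj₁ (_ , refl)    = irrefl e₂
    ... | inj₂ (refl , refl) | inj₂ (refl , refl) | inj₂ (refl , refl) = tri e₁ e₃ e₂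

-- The graph of `next` on natural numbers, where short cycles are refuted by unification.
data Succ (n : ℕ) : ℕ → ℕ → Set where
  step : ∀ {a} → Succ n a (suc a)
  wrap : ∀ {a} → suc a ≡ n → Succ n a 0

next-fromℕ : ∀ n → next (fromℕ n) ≡ zero
next-fromℕ n with toℕ (fromℕ n) ℕ.<? n
... | yes p = contradiction (subst (_< n) (Finₚ.toℕ-fromℕ n) p) (ℕₚ.<-irrefl refl)
... | no _  = refl

next-inject₁ : ∀ {n} (i : Fin n) → next (inject₁ i) ≡ suc i
next-inject₁ {n} i with toℕ (inject₁ i) ℕ.<? n
... | yes p = Finₚ.toℕ-injective (cong suc (trans (Finₚ.toℕ-fromℕ< p) (Finₚ.toℕ-inject₁ i)))
... | no ¬p = contradiction (Finₚ.inject₁ℕ< i) ¬p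

next-succ : ∀ {n} (i : Fin n) → Succ n (toℕ i) (toℕ (next i))
next-succ {suc n} i with view i
... | ‵fromℕ     rewrite next-fromℕ n = wrap (cong suc (Finₚ.toℕ-fromℕ n))
... | ‵inject₁ k rewrite next-inject₁ k | Finₚ.toℕ-inject₁ k = step

succ-injective : ∀ {n a b c} → Succ n a c → Succ n b c → a ≡ b
succ-injective step step = refl
succ-injective (wrap p) (wrap q) = ℕₚ.suc-injective (trans p (sym q))

next-injective : ∀ {n} {i j : Fin n} → next i ≡ next j → i ≡ j
next-injective {i = i} {j} e =
  Finₚ.toℕ-injective (succ-injective (next-succ i) (subst (Succ _ (toℕ j) ∘ toℕ) (sym e) (next-succ j)))

no-2-cycle : ∀ {n a b} → Succ (3 + n) a b → Succ (3 + n) b a → ⊥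
no-2-cycle step (wrap ())
no-2-cycle (wrap ()) step
no-2-cycle (wrap _) (wrap ())

-- Length at least four is essential: the 2-token graph of a 3-cycle is itself a triangle.
no-3-cycle : ∀ {n a b c} → Succ (4 + n) a b → Succ (4 + n) b c → Succ (4 + n) c a → ⊥
no-3-cycle step step (wrap ())
no-3-cycle step (wrap ()) step
no-3-cycle step (wrap _) (wrap ())
no-3-cycle (wrap ()) step step
no-3-cycle (wrap refl) (wrap ()) _

next-no-2-cycle : ∀ {n} (i : Fin (3 + n)) → next (next i) ≢ i
next-no-2-cycle i e = no-2-cycle (next-succ i) (subst (λ j → Succ _ (toℕ (next i)) (toℕ j)) e (next-succ (next i)))

next-no-3-cycle : ∀ {n} (i : Fin (4 + n)) → next (next (next i)) ≢ i
next-no-3-cycle i e = no-3-cycle (next-succ i) (next-succ (next i))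
  (subst (λ j → Succ _ (toℕ (next (next i))) (toℕ j)) e (next-succ (next (next i))))

injective⇒surjective : ∀ {n} {f : Fin n → Fin n} → Injective _≡_ _≡_ f → ∀ y → ∃ λ x → f x ≡ y
injective⇒surjective {suc n} {f} f-inj y with Finₚ.any? (λ x → f x Finₚ.≟ y)
... | yes p = p
... | no ¬p = contradiction (λ {x} {z} e → f-inj (Finₚ.punchOut-injective (missed x) (missed z) e))
                            (Finₚ.<⇒notInjective (ℕₚ.n<1+n n))
  where
  missed : ∀ x → y ≢ f x
  missed x e = ¬p (x , sym e)

module _ {n} {G : Graph n} where

  cycleEdge⇒E : ∀ (H : HamiltonianCycle G) {u v} → CycleEdge H u v → Graph.E G u v
  cycleEdge⇒E H (i , inj₁ (refl , refl)) = HamiltonianCycle.c-adj H i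
  cycleEdge⇒E H (i , inj₂ (refl , refl)) = Graph.sym G (HamiltonianCycle.c-adj H i)

  cycleGraph : HamiltonianCycle G → Graph n
  cycleGraph H = record
    { E      = CycleEdge H
    ; sym    = λ (i , e) → i , swap e
    ; irrefl = Graph.irrefl G ∘ cycleEdge⇒E H
    }

  F₂-map : ∀ (H : HamiltonianCycle G) {X Y} → F₂ (cycleGraph H) X Y → F₂ G X Y
  F₂-map H (x , y , e , rest) = x , y , cycleEdge⇒E H e , rest

module _ {n} {G : Graph (4 + n)} (H : HamiltonianCycle G) where
  open HamiltonianCycle H

  private
    position : Fin (4 + n) → Fin (4 + n)
    position v = proj₁ (injective⇒surjective c-inj v)

    c-position : ∀ v → c (position v) ≡ v
    c-position v = proj₂ (injective⇒surjective c-inj v)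

    Arc : Rel (Fin (4 + n))
    Arc u v = ∃ λ i → u ≡ c i × v ≡ c (next i)

    arcs : ∀ {u v} → CycleEdge H u v → Arc u v ⊎ Arc v u
    arcs (i , inj₁ p) = inj₁ (i , p)
    arcs (i , inj₂ p) = inj₂ (i , p)

    arc-irrefl : ∀ {u} → ¬ Arc u u
    arc-irrefl (i , p) = Graph.irrefl G (cycleEdge⇒E H (i , inj₁ p))

    arc-functional : ∀ {u v w} → Arc u v → Arc u w → v ≡ w
    arc-functional (i , refl , refl) (j , e , refl) = cong (c ∘ next) (c-inj e)

    arc-injective : ∀ {u v w} → Arc u w → Arc v w → u ≡ v
    arc-injective (i , refl , refl) (j , refl , e) = cong c (next-injective (c-inj e))

    arc-3-cycle : ∀ {u v w} → Arc u v → Arc v w → Arc w u → ⊥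
    arc-3-cycle (i , refl , refl) (j , e , refl) (k , f , g) = next-no-3-cycle i (sym
      (trans (c-inj g) (cong next (trans (sym (c-inj f)) (cong next (sym (c-inj e)))))))

  -- Orient the edges along `H`. A cyclically oriented triangle contradicts `next-no-3-cycle`; in
  -- any other orientation two arcs share a source or a target, so they coincide and the third is a
  -- loop.
  cycle-triangle-free : ∀ {x y z} → CycleEdge H x y → CycleEdge H y z → CycleEdge H z x → ⊥
  cycle-triangle-free p q r with arcs p | arcs q | arcs r
  ... | inj₁ xy | inj₁ yz | inj₁ zx = arc-3-cycle xy yz zx
  ... | inj₁ xy | inj₁ yz | inj₂ xz with refl ← arc-functional xy xz = arc-irrefl yz
  ... | inj₁ xy | inj₂ zy | inj₁ zx with refl ← arc-injective xy zy = arc-irrefl zx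
  ... | inj₁ xy | inj₂ zy | inj₂ xz with refl ← arc-functional xy xz = arc-irrefl zy
  ... | inj₂ yx | inj₁ yz | inj₁ zx with refl ← arc-injective yx zx = arc-irrefl yz
  ... | inj₂ yx | inj₁ yz | inj₂ xz with refl ← arc-functional yx yz = arc-irrefl xz
  ... | inj₂ yx | inj₂ zy | inj₁ zx with refl ← arc-injective yx zx = arc-irrefl zy
  ... | inj₂ yx | inj₂ zy | inj₂ xz = arc-3-cycle zy yx xz

  open Grid (3 + n) using (gridMap; vertexNumber; vertexNumber-injective; GridAdj;
                           eastward; northward; around; converse; gridAdj⇒MapAdj)

  private
    sorted : (a b : Fin (4 + n)) → Fin (4 + n) × Fin (4 + n)
    sorted a b with a Finₚ.<? b
    ... | yes _ = a , b
    ... | no _  = b , a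

    sorted-< : ∀ {a b} → a Fin.< b → sorted a b ≡ (a , b) × sorted b a ≡ (a , b)
    sorted-< {a} {b} a<b with a Finₚ.<? b | b Finₚ.<? a
    ... | no ¬p | _     = contradiction a<b ¬p
    ... | yes _ | yes q = contradiction q (Finₚ.<-asym a<b)
    ... | yes _ | no _  = refl , refl

    sorted-match : ∀ {a b a′ b′} → sorted a b ≡ sorted a′ b′ → (a ≡ a′ × b ≡ b′) ⊎ (a ≡ b′ × b ≡ a′)
    sorted-match {a} {b} {a′} {b′} e with a Finₚ.<? b | a′ Finₚ.<? b′
    sorted-match refl | yes _ | yes _ = inj₁ (refl , refl)
    sorted-match refl | yes _ | no _  = inj₂ (refl , refl)
    sorted-match refl | no _  | yes _ = inj₂ (refl , refl)
    sorted-match refl | no _  | no _  = inj₁ (refl , refl)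

    -- Tokens are compared by their positions along `H`, not by their labels in `G`, so that a step
    -- along `H` is a unit step in the grid.
    place : Pair (4 + n) → Fin (4 + n) × Fin (4 + n)
    place ((u , v) , _) = sorted (position u) (position v)

    position-c : ∀ i → position (c i) ≡ i
    position-c i = c-inj (c-position (c i))

    place-is : ∀ {X a b} → Is X (c a) (c b) → a Fin.< b → place X ≡ (a , b)
    place-is {a = a} {b} ascending a<b =
      trans (cong₂ sorted (position-c a) (position-c b)) (proj₁ (sorted-< a<b))
    place-is {a = a} {b} descending a<b =
      trans (cong₂ sorted (position-c b) (position-c a)) (proj₂ (sorted-< a<b))

    position-injective : ∀ {u v} → position u ≡ position v → u ≡ v
    position-injective {u} {v} e = trans (sym (c-position u)) (trans (cong c e) (c-position v))

    place-injective : ∀ {X Y} → place X ≡ place Y → X ≡ Y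
    place-injective {X@((u , v) , _)} {Y@((u′ , v′) , _)} e =
      [ (λ (p , q) → same-order (position-injective p) (position-injective q))
      , (λ (p , q) → opposite-order (position-injective p) (position-injective q)) ] (sorted-match e)
      where
      same-order : u ≡ u′ → v ≡ v′ → X ≡ Y
      same-order refl refl = is-unique ascending ascending
      opposite-order : u ≡ v′ → v ≡ u′ → X ≡ Y
      opposite-order refl refl = is-unique ascending descending

    place-adjacent : ∀ X Y {p q} → place X ≡ p → place Y ≡ q → GridAdj p q → GridAdj (place X) (place Y)
    place-adjacent _ _ refl refl adj = adj

    arc-adjacent : ∀ i p {X Y} → Is X (c i) (c p) → Is Y (c (next i)) (c p) → GridAdj (place X) (place Y)
    arc-adjacent i p {X} {Y} s t with view i
    -- The moving token was the larger coordinate and becomes the smaller one, 0.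
    ... | ‵fromℕ rewrite next-fromℕ (3 + n) = place-adjacent X Y
      (place-is (is-swap s) (Finₚ.≤∧≢⇒< (Finₚ.≤fromℕ p) (λ { refl → is-distinct s refl })))
      (place-is t (Finₚ.≤∧≢⇒< z≤n (λ { refl → is-distinct t refl })))
      (around p)
    ... | ‵inject₁ k rewrite next-inject₁ k with Finₚ.<-cmp p (inject₁ k)
    ... | tri≈ _ refl _ = contradiction refl (is-distinct s)
    -- The moving token is the larger coordinate, the column.
    ... | tri< p<k _ _ = place-adjacent X Y
      (place-is (is-swap s) p<k)
      (place-is (is-swap t) (ℕₚ.<-trans p<k (s≤s (ℕₚ.≤-reflexive (Finₚ.toℕ-inject₁ k)))))
      (eastward p k)
    -- The moving token is the row; it stays below `p` because it may not land on the resting token.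
    ... | tri> _ _ k<p = place-adjacent X Y
      (place-is s k<p)
      (place-is t (Finₚ.≤∧≢⇒< (subst (λ x → suc x ≤ toℕ p) (Finₚ.toℕ-inject₁ k) k<p)
                              (λ { refl → is-distinct t refl })))
      (northward k p)

  F₂-cycle-embeds : EmbedsInProjectivePlane (F₂ (cycleGraph H))
  F₂-cycle-embeds = gridMap , vertexNumber ∘ place , place-injective ∘ vertexNumber-injective ,
    λ X Y f → gridAdj⇒MapAdj (adjacent (F₂⇒move X Y f))
    where
    adjacent : ∀ {X Y} → Move (cycleGraph H) X Y → GridAdj (place X) (place Y)
    adjacent (move {still = w} e s t) with arcs e | injective⇒surjective c-inj w
    ... | inj₁ (i , refl , refl) | p , refl = arc-adjacent i p s t
    ... | inj₂ (i , refl , refl) | p , refl = converse (arc-adjacent i p t s)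

  F₂-cycle-girth : GirthAtLeast 4 (F₂ (cycleGraph H))
  F₂-cycle-girth (suc (suc (suc zero))) _ _ X _ adj =
    F₂-triangle-free {G = cycleGraph H} cycle-triangle-free
      (X zero) (X (suc zero)) (X (suc (suc zero))) (adj zero) (adj (suc zero)) (adj (suc (suc zero)))
  F₂-cycle-girth (suc (suc (suc (suc _)))) _ (s≤s (s≤s (s≤s (s≤s ())))) _ _ _
  F₂-cycle-girth (suc (suc zero)) (s≤s (s≤s ()))
  F₂-cycle-girth (suc zero) (s≤s ())

cover-by-cycles : ∀ {n k} {G : Graph (4 + n)} → HamDecomposition G k → PPGirthCover 4 (F₂ G) k
cover-by-cycles {G = G} (cs , covers , _) =
  (λ j → F₂ (cycleGraph (cs j))) ,
  (λ j X Y → F₂-map (cs j) {X} {Y}) ,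
  (λ j → F₂-sym {G = cycleGraph (cs j)}) ,
  (λ { X Y (x , y , e , rest) → let j , e′ = covers x y e in j , x , y , e′ , rest }) ,
  (λ j → F₂-cycle-embeds (cs j) , F₂-cycle-girth (cs j))

-- Edge counts in F₂(G)

-- Enumerates the places left for a resting token: `punchOut u≢v` is the index of `v` once `u` has
-- been removed.
third : ∀ {n} {u v : Fin (2 + n)} → u ≢ v → Fin n → Fin (2 + n)
third {u = u} u≢v t = punchIn u (punchIn (punchOut u≢v) t)

third-injective : ∀ {n} {u v : Fin (2 + n)} (u≢v : u ≢ v) → Injective _≡_ _≡_ (third u≢v)
third-injective {u = u} u≢v = Finₚ.punchIn-injective (punchOut u≢v) _ _ ∘ Finₚ.punchIn-injective u _ _

third≢first : ∀ {n} {u v : Fin (2 + n)} (u≢v : u ≢ v) t → u ≢ third u≢v t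
third≢first {u = u} u≢v t = Finₚ.punchInᵢ≢i u _ ∘ sym

third≢second : ∀ {n} {u v : Fin (2 + n)} (u≢v : u ≢ v) t → v ≢ third u≢v t
third≢second {u = u} u≢v t e = Finₚ.punchInᵢ≢i (punchOut u≢v) t
  (Finₚ.punchIn-injective u _ _ (trans (sym e) (sym (Finₚ.punchIn-punchOut u≢v))))

-- The two ends of an edge of the token graph determine the edge of `G` traversed, with its
-- direction, and the resting token; hence counting moves counts edges.
same-move : ∀ {n} {X Y : Pair n} {u v w u′ v′ w′} → u ≢ v →
  Is X u w → Is Y v w → Is X u′ w′ → Is Y v′ w′ → u ≡ u′ × v ≡ v′ × w ≡ w′
same-move u≢v Xuw Yvw Xuw′ Yvw′ with is-match Xuw Xuw′ | is-match Yvw Yvw′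
... | inj₁ (refl , refl) | inj₁ (refl , _)    = refl , refl , refl
... | inj₁ (refl , refl) | inj₂ (refl , _)    = contradiction refl (is-distinct Yvw)
... | inj₂ (refl , refl) | inj₁ (refl , refl) = contradiction refl (is-distinct Xuw)
... | inj₂ (refl , refl) | inj₂ (refl , _)    = contradiction refl u≢v

triangle-free : ∀ {V : Set} {P : Rel V} → (∀ a → ¬ P a a) → GirthAtLeast 4 P →
  ∀ {a b c} → P a b → P b c → P c a → ⊥
triangle-free {V} {P} irrefl girth {a} {b} {c} ab bc ca =
  girth 3 ℕₚ.≤-refl ℕₚ.≤-refl f f-inj λ { zero → ab ; (suc zero) → bc ; (suc (suc zero)) → ca }
  where
  f : Fin 3 → V
  f zero             = a
  f (suc zero)       = b
  f (suc (suc zero)) = c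
  distinct : ∀ {x y} → P x y → x ≢ y
  distinct p refl = irrefl _ p
  f-inj : Injective _≡_ _≡_ f
  f-inj {zero}           {zero}           _ = refl
  f-inj {zero}           {suc zero}       e = contradiction e (distinct ab)
  f-inj {zero}           {suc (suc zero)} e = contradiction (sym e) (distinct ca)
  f-inj {suc zero}       {zero}           e = contradiction (sym e) (distinct ab)
  f-inj {suc zero}       {suc zero}       _ = refl
  f-inj {suc zero}       {suc (suc zero)} e = contradiction e (distinct bc)
  f-inj {suc (suc zero)} {zero}           e = contradiction e (distinct ca)
  f-inj {suc (suc zero)} {suc zero}       e = contradiction (sym e) (distinct bc)
  f-inj {suc (suc zero)} {suc (suc zero)} _ = refl

-- The abstract graph is carried to the map as its image `R` under `φ`; injectivity of `φ` preserves
-- triangle-freeness and simplicity, and the witnesses of `MapAdj` supply the flag of each edge.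
embedded-edge-bound : ∀ {V : Set} {P : Rel V} → (∀ a b → P a b → P b a) → (∀ a → ¬ P a a) →
  GirthAtLeast 4 P → EmbedsInProjectivePlane P →
  (v : V) (vs : List V) → (∀ a → a ∈ (v ∷ vs)) → 1 ≤ length vs →
  ∀ {m} (src tgt : Fin m → V) → (∀ i → P (src i) (tgt i)) →
  (∀ {i j} → (src i ≡ src j × tgt i ≡ tgt j) ⊎ (src i ≡ tgt j × tgt i ≡ src j) → i ≡ j) →
  m + 2 ≤ (1 + length vs) * 2
embedded-edge-bound {V} {P} P-sym P-irrefl girth (M , φ , φ-inj , embeds) v vs total 1≤ {m} src tgt joins simple =
  subst (λ l → m + 2 ≤ (1 + l) * 2) (length-map φ vs)
    (T.edge-bound s-R s-simple (φ v) (map φ vs)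
      (λ i → subst (_∈ map φ (v ∷ vs)) (sym (source i)) (∈-map⁺ φ (total (src i)))
           , subst (_∈ map φ (v ∷ vs)) (sym (target i)) (∈-map⁺ φ (total (tgt i))))
      (subst (1 ≤_) (sym (length-map φ vs)) 1≤))
  where
  open ProjectivePlaneMap M using (#V; flags; vert; τ₀)
  s : Fin m → Fin flags
  s i = proj₁ (embeds (src i) (tgt i) (joins i))
  source : ∀ i → vert (s i) ≡ φ (src i)
  source i = proj₁ (proj₂ (embeds (src i) (tgt i) (joins i)))
  target : ∀ i → vert (τ₀ (s i)) ≡ φ (tgt i)
  target i = proj₂ (proj₂ (embeds (src i) (tgt i) (joins i)))
  R : Rel (Fin #V)
  R x y = ∃₂ λ a b → P a b × x ≡ φ a × y ≡ φ b
  R-sym : ∀ {x y} → R x y → R y x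
  R-sym (a , b , p , e , f) = b , a , P-sym a b p , f , e
  R-irrefl : ∀ {x} → ¬ R x x
  R-irrefl (a , b , p , e , f) with refl ← φ-inj (trans (sym e) f) = P-irrefl a p
  R-triangle-free : ∀ {x y z} → R x y → R y z → R z x → ⊥
  R-triangle-free (a , b , p , e , f) (b′ , c , q , g , h) (c′ , a′ , r , k , l)
    with refl ← φ-inj (trans (sym f) g) | refl ← φ-inj (trans (sym h) k) | refl ← φ-inj (trans (sym l) e)
    = triangle-free {P = P} P-irrefl girth p q r
  module T = TriangleFreeSubgraph M R R-sym R-irrefl R-triangle-free s
  s-R : ∀ i → R (vert (s i)) (vert (τ₀ (s i)))
  s-R i = src i , tgt i , joins i , source i , target i
  s-simple : ∀ {i j} → T.SameEnds (s i) (s j) → i ≡ j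
  s-simple {i} {j} (T.aligned p q) = simple (inj₁
    ( φ-inj (trans (sym (source i)) (trans p (source j)))
    , φ-inj (trans (sym (target i)) (trans q (target j)))))
  s-simple {i} {j} (T.reversed p q) = simple (inj₂
    ( φ-inj (trans (sym (source i)) (trans p (target j)))
    , φ-inj (trans (sym (target i)) (trans q (source j)))))

module _ {n k} {G : Graph (4 + n)} (D : HamDecomposition G k) where

  private
    cs = proj₁ D
    module H j = HamiltonianCycle (cs j)

    disjoint : ∀ {u v j j′} → CycleEdge (cs j) u v → CycleEdge (cs j′) u v → j ≡ j′
    disjoint = proj₂ (proj₂ D) _ _ _ _

    -- A cycle, an edge of it, and one of the n - 2 places for the resting token, where n is the
    -- order: in all k n (n - 2) edges.
    Index : Set
    Index = Fin k × Fin (4 + n) × Fin (2 + n)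

    tail head rest : Index → Fin (4 + n)
    tail (j , i , t) = H.c j i
    head (j , i , t) = H.c j (next i)

    tail≢head : ∀ x → tail x ≢ head x
    tail≢head (j , i , t) e =
      Graph.irrefl G (subst (Graph.E G (H.c j i)) (sym e) (H.c-adj j i))

    rest x@(_ , _ , t) = third (tail≢head x) t

    source : ∀ x → ∃ λ X → Is X (tail x) (rest x)
    source x@(_ , _ , t) = pair (third≢first (tail≢head x) t)

    target : ∀ x → ∃ λ X → Is X (head x) (rest x)
    target x@(_ , _ , t) = pair (third≢second {u = tail x} (tail≢head x) t)

    F₂-index : ∀ x → F₂ G (proj₁ (source x)) (proj₁ (target x))
    F₂-index x@(j , i , t) = move⇒F₂ {G = G} (move (H.c-adj j i) (proj₂ (source x)) (proj₂ (target x)))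

    forward : ∀ x y → tail x ≡ tail y → head x ≡ head y → rest x ≡ rest y → x ≡ y
    forward (j , i , t) (j′ , i′ , t′) p q r
      with refl ← disjoint (i , inj₁ (refl , refl)) (i′ , inj₁ (p , q))
      with refl ← H.c-inj j p
      = cong (λ t → j , i , t) (third-injective (tail≢head (j , i , t)) r)

    -- No edge is listed in both directions: otherwise two steps along a cycle would return to the
    -- start.
    backward : ∀ x y → tail x ≡ head y → head x ≡ tail y → x ≡ y
    backward (j , i , t) (j′ , i′ , t′) p q
      with refl ← disjoint (i , inj₁ (refl , refl)) (i′ , inj₂ (q , p))
      = contradiction (trans (cong next (sym (H.c-inj j p))) (H.c-inj j q)) (next-no-2-cycle i′)

    index-simple : ∀ {x y} →
      (proj₁ (source x) ≡ proj₁ (source y) × proj₁ (target x) ≡ proj₁ (target y)) ⊎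
      (proj₁ (source x) ≡ proj₁ (target y) × proj₁ (target x) ≡ proj₁ (source y)) → x ≡ y
    index-simple {x} {y} (inj₁ (p , q)) =
      let a , b , c = same-move (tail≢head x) (proj₂ (source x)) (proj₂ (target x))
            (subst (λ X → Is X (tail y) (rest y)) (sym p) (proj₂ (source y)))
            (subst (λ X → Is X (head y) (rest y)) (sym q) (proj₂ (target y)))
      in forward x y a b c
    index-simple {x} {y} (inj₂ (p , q)) =
      let a , b , _ = same-move (tail≢head x) (proj₂ (source x)) (proj₂ (target x))
            (subst (λ X → Is X (head y) (rest y)) (sym p) (proj₂ (target y)))
            (subst (λ X → Is X (tail y) (rest y)) (sym q) (proj₂ (source y)))
      in backward x y a b

  -- The vertex `zero` and its successors on the `k` cycles are pairwise distinct, since a common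
  -- successor would put one edge on two cycles.
  cycle-count : suc k ≤ 4 + n
  cycle-count = Finₚ.injective⇒≤ {f = f} f-inj
    where
    at : ∀ j → ∃ λ i → H.c j i ≡ zero
    at j = injective⇒surjective (H.c-inj j) zero
    f : Fin (suc k) → Fin (4 + n)
    f zero    = zero
    f (suc j) = H.c j (next (proj₁ (at j)))
    edge : ∀ j → CycleEdge (cs j) zero (f (suc j))
    edge j = proj₁ (at j) , inj₁ (sym (proj₂ (at j)) , refl)
    loopless : ∀ j → zero ≢ f (suc j)
    loopless j e = Graph.irrefl G (subst (Graph.E G zero) (sym e) (cycleEdge⇒E (cs j) (edge j)))
    f-inj : Injective _≡_ _≡_ f
    f-inj {zero}  {zero}   _ = refl
    f-inj {zero}  {suc j}  e = contradiction e (loopless j)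
    f-inj {suc j} {zero}   e = contradiction (sym e) (loopless j)
    f-inj {suc j} {suc j′} e =
      cong suc (disjoint (edge j) (subst (CycleEdge (cs j′) zero) (sym e) (edge j′)))

  private
    unindex : Fin (k * ((4 + n) * (2 + n))) → Index
    unindex x = let j , y = remQuot {k} ((4 + n) * (2 + n)) x in j , remQuot {4 + n} (2 + n) y

    unindex-injective : Injective _≡_ _≡_ unindex
    unindex-injective {x} {y} e =
      trans (sym (Finₚ.combine-remQuot {k} _ x)) (trans
        (cong₂ combine (cong proj₁ e) (trans (sym (Finₚ.combine-remQuot {4 + n} (2 + n) _))
          (trans (cong (λ z → combine (proj₁ (proj₂ z)) (proj₂ (proj₂ z))) e)
                 (Finₚ.combine-remQuot {4 + n} (2 + n) _))))
        (Finₚ.combine-remQuot {k} _ y))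

  -- Each edge is coloured by one subgraph containing it. A colour class has at most 2N - 2 edges,
  -- and for N = (4 + n)(3 + n) / 2 this number is (2 + n)(5 + n).
  cover-edge-bound : ∀ {j} → PPGirthCover 4 (F₂ G) j →
    k * ((4 + n) * (2 + n)) ≤ j * ((2 + n) * (5 + n))
  cover-edge-bound {j} (P , P⊆F₂ , P-sym , covers , props) = bounded-fibres _ colour fibre
    where
    colour : Fin (k * ((4 + n) * (2 + n))) → Fin j
    colour x = proj₁ (covers _ _ (F₂-index (unindex x)))
    coloured : ∀ x → P (colour x) (proj₁ (source (unindex x))) (proj₁ (target (unindex x)))
    coloured x = proj₂ (covers _ _ (F₂-index (unindex x)))
    size : ∀ L → length L * 2 ≡ (4 + n) * (3 + n) → (∀ X → X ∈ L) →
      ∀ i m (s : Fin m → Fin (k * ((4 + n) * (2 + n)))) → Injective _≡_ _≡_ s →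
      (∀ x → colour (s x) ≡ i) → m ≤ (2 + n) * (5 + n)
    -- The length equation leaves at least two pairs, as the edge bound requires; the first plays
    -- the part of `v₀`.
    size (X ∷ []) ()
    size (X ∷ Y ∷ L) len total i m s s-inj monochrome = ℕₚ.+-cancelʳ-≤ 2 _ _
      (subst (m + 2 ≤_) (trans len (arith n))
        (embedded-edge-bound (P-sym i) (λ X p → F₂-irrefl {G = G} X (P⊆F₂ i X X p)) (proj₂ (props i)) (proj₁ (props i))
          X (Y ∷ L) total (s≤s z≤n)
          (λ x → proj₁ (source (unindex (s x)))) (λ x → proj₁ (target (unindex (s x))))
          (λ x → subst (λ i → P i _ _) (monochrome x) (coloured (s x)))
          (s-inj ∘ unindex-injective ∘ index-simple)))
      where
      arith : ∀ n → (4 + n) * (3 + n) ≡ (2 + n) * (5 + n) + 2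
      arith = solve-∀
    fibre = size (allPairs (4 + n)) (length-allPairs (3 + n)) ∈-allPairs

  -- After cancelling `2 + n`, the bound with j + 1 in place of k reads (j + 1)(4 + n) ≤ j + j (4 +
  -- n). Hence 4 + n ≤ j, against j < k < 4 + n.
  no-smaller-cover : ∀ j → suc j ≤ k → ¬ PPGirthCover 4 (F₂ G) j
  no-smaller-cover j j<k cover = ℕₚ.<-irrefl refl (begin-strict
    j               <⟨ j<k ⟩
    k               <⟨ cycle-count ⟩
    4 + n           ≤⟨ ℕₚ.+-cancelʳ-≤ (j * (4 + n)) _ _ few ⟩
    j               ∎)
    where
    open ℕₚ.≤-Reasoning
    few : 4 + n + j * (4 + n) ≤ j + j * (4 + n)
    few = ℕₚ.*-cancelʳ-≤ _ _ (2 + n) (begin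
      suc j * (4 + n) * (2 + n)     ≤⟨ ℕₚ.*-monoˡ-≤ (2 + n) (ℕₚ.*-monoˡ-≤ (4 + n) j<k) ⟩
      k * (4 + n) * (2 + n)         ≡⟨ ℕₚ.*-assoc k (4 + n) (2 + n) ⟩
      k * ((4 + n) * (2 + n))       ≤⟨ cover-edge-bound cover ⟩
      j * ((2 + n) * (5 + n))       ≡⟨ arith j n ⟩
      (j + j * (4 + n)) * (2 + n)   ∎)
      where
      arith : ∀ j n → j * ((2 + n) * (5 + n)) ≡ (j + j * (4 + n)) * (2 + n)
      arith = solve-∀

theorem2 : (n : ℕ) (G : Graph n) (k : ℕ) → 4 ≤ n →
    HamDecomposition G k → PPGirthThicknessIs 4 (F₂ G) k
theorem2 (suc (suc (suc (suc n)))) G k (s≤s (s≤s (s≤s (s≤s z≤n)))) D =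
  cover-by-cycles D , no-smaller-cover D
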